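{- Let $k\geqslant 4$ be an integer and let $0\leqslant \delta<\frac{1}{64k^2}$. Let $n\geqslant 32k$ be even and let $N=\lceil (k-\frac14)n\rceil$. Suppose $G$ is a graph on $N$ vertices with at least $(1-\delta)\binom{N}{2}$ edges, whose edges are coloured with $k$ colours. Then $G$ contains a monochromatic connected matching of $\frac{n}{2}$ edges.
   Context: A monochromatic connected matching of $m$ edges in an edge-coloured graph $G$ is a connected subgraph of $G$, all of whose edges have the same colour, which contains a matching of $m$ edges (equivalently, a matching of $m$ edges of one colour all of whose edges lie in a single connected component of the graph formed by the edges of that colour). -}

module Defs where

open import Data.Nat using (ℕ; zero; suc; _+_; _*_)
open import Data.Fin using (Fin; _<_; _<?_)
open import Data.Maybe using (Maybe; just; nothing; is-just)
open import Data.Bool using (Bool; true; false; if_then_else_)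
open import Data.Product using (_×_; _,_; proj₁; proj₂)
open import Data.List using (List; length; filter; cartesianProduct; allFin)

open import Relation.Nullary using (¬_)
open import Relation.Binary.PropositionalEquality using (_≡_)

-- A k-edge-coloured simple graph on vertex set Fin N:
-- c u v = nothing  means uv is not an edge; c u v = just i means uv is an edge of colour i.
record ColouredGraph (N k : ℕ) : Set where
  field
    col       : Fin N → Fin N → Maybe (Fin k)
    symmetric : ∀ u v → col u v ≡ col v u
    loopless  : ∀ u → col u u ≡ nothing
open ColouredGraph public

edgeCount : ∀ {N k} → ColouredGraph N k → ℕ
edgeCount {N} G =
  length (filter (λ p → proj₁ p <? proj₂ p)
         (filter (λ p → Data.Maybe.is-just (col G (proj₁ p) (proj₂ p)) Data.Bool.≟ true)
                 (cartesianProduct (allFin N) (allFin N))))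

data Conn {N k : ℕ} (G : ColouredGraph N k) (i : Fin k) : Fin N → Fin N → Set where
  here : ∀ {u} → Conn G i u u
  step : ∀ {u v w} → col G u v ≡ just i → Conn G i v w → Conn G i u w

endpoint : ∀ {N s} → (Fin s → Fin N × Fin N) → Fin s → Bool → Fin N
endpoint e j true  = proj₁ (e j)
endpoint e j false = proj₂ (e j)

record MonoConnMatching {N k : ℕ} (G : ColouredGraph N k) (s : ℕ) : Set where
  field
    colour    : Fin k
    edge      : Fin s → Fin N × Fin N
    coloured  : ∀ j → col G (proj₁ (edge j)) (proj₂ (edge j)) ≡ just colour
    disjoint  : ∀ j j' b b' → endpoint edge j b ≡ endpoint edge j' b' → (j ≡ j') × (b ≡ b')
    connected : ∀ j j' → Conn G colour (proj₁ (edge j)) (proj₁ (edge j'))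

{-# OPTIONS --safe #-}

-- Write n = 2m and N = 2km − f with f = ⌊m/2⌋, and count ordered pairs of vertices.
-- If no colour has a connected matching of m edges, then a class (component) of size c of a
-- colour covers at most 2mc pairs, so the k colours cover at most 2kmN = N² + Nf pairs.  All
-- but m²/16 of the N² pairs are covered, and Nf ≤ (k − 1)m² + f(2m − f), so it suffices to find
-- savings exceeding (k − 1)m² + f(2m − f) + m²/16.  There are two kinds of them.
--
-- Loss.  A matching without augmenting paths of length 1, 3, 5 gives an Erdős–Gallai bound: a
-- class of size c ≤ 2m loses c(2m − c) pairs, one of size between 2m and 3m loses at least
-- m(c − 2m), and one of size at least 3m ("large") loses at least m² + (m − h)², where h is the
-- number of matching edges with an end ("hub") seeing two unmatched vertices.  As 2m does not
-- divide N, a colour without large classes still loses f(2m − f).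
--
-- Overlap.  Fix a colour b of loss below m².  Its classes are essentially at most k cliques, and
-- the pairs inside them are counted again by every other colour: by the cliques of a colour
-- without large classes, or by the hub set of a large class, which cannot avoid all of the at
-- most k cliques of b.  Hence every colour other than b saves m² and a bit more.
module Submission where

open import Defs
open import Data.Nat
open import Data.Nat.Properties
open import Data.Nat.Tactic.RingSolver using (solve-∀)
open import Data.Nat.Divisibility using (_∣_; divides; n∣m*n)
open import Data.Nat.DivMod using (m*n/n≡m; +-distrib-/-∣ʳ; m<n⇒m/n≡0)
open import Data.Bool using (Bool; true; false; not; _∧_; _∨_)
import Data.Bool.Properties as B
open import Data.Fin using (Fin; zero; suc)
import Data.Fin as F
import Data.Fin.Properties as F
open import Data.Maybe using (Maybe; just; nothing; is-nothing; is-just)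
import Data.Maybe.Properties as Maybe
open import Data.List using (List; []; _∷_; _++_; map; length; filter; tabulate; allFin; cartesianProduct)
open import Data.List.Membership.Propositional using (_∈_)
open import Data.List.Membership.Propositional.Properties using (∈-cartesianProduct⁺; ∈-allFin)
open import Data.List.Relation.Unary.Any using (here; there)
open import Data.Product using (Σ; ∃; ∃₂; _×_; _,_; proj₁; proj₂; map₁; map₂)
open import Data.Sum using (_⊎_; inj₁; inj₂)
open import Data.Empty using (⊥; ⊥-elim)
import Data.Integer as ℤ
import Data.Integer.Properties as ℤ
open import Data.Rational using (ℚ; 0ℚ; 1ℚ; _-_) renaming (_*_ to _*ℚ_; _+_ to _+ℚ_; _≤_ to _≤ℚ_; _<_ to _<ℚ_; _/_ to _/ℚ_; -_ to -ℚ_)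
import Data.Rational.Properties as ℚ
open import Data.Rational.Unnormalised using (mkℚᵘ; *≡*)
import Data.Rational.Unnormalised.Properties as ℚᵘ
open import Function using (_∘_; id; case_of_)
open import Relation.Nullary using (Dec; yes; no; does; ¬_)
open import Relation.Nullary.Decidable using (_×-dec_; ¬?; map′; dec-true; dec-false)
open import Relation.Unary using (Decidable)
open import Relation.Binary using (tri<; tri≈; tri>)
open import Relation.Binary.PropositionalEquality
open import Algebra.Properties.Semiring.Sum +-*-semiring using (sum; sum-cong-≗; ∑-distrib-+; ∑-comm; *-distribˡ-sum; *-distribʳ-sum; sum-syntax)

-- Sums over finite index sets

-- Inside a class every pair of a chosen `core` is charged to the colour, whether or not it has that
-- colour. This overcharging makes overlaps visible: a pair in cores of two colours is charged
-- twice, although an edge has only one colour. A core must therefore miss few vertices (`waste`)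
-- and still keep the load of the class low; this tension is behind the case distinction by the
-- number of hubs. The budget is tight: m² from each colour but one, plus f(2m - f) from the
-- remaining colour `b`, falls short by just m²/16. A bonus of m²/(8k) per colour other than `b`
-- closes the gap, as (k - 1)/(8k) > 1/16. For a colour with a large class, the bonus requires that
-- the cores of `b` miss at most m/16 vertices. To get this the budget is used twice: gains of m²
-- alone confine the surplus of `b` to m²/16, hence its waste to m/16, and only then do the hubs
-- yield the bonus. A suitable `b` exists since losses of m² in all k colours would exceed the
-- budget, f being at least m/3.

sum-mono : ∀ {n} {f g : Fin n → ℕ} → (∀ i → f i ≤ g i) → sum f ≤ sum g
sum-mono {zero} p = z≤n
sum-mono {suc n} p = +-mono-≤ (p zero) (sum-mono (p ∘ suc))

sum-const : ∀ n c → ∑[ i < n ] c ≡ n * c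
sum-const zero c = refl
sum-const (suc n) c = cong (c +_) (sum-const n c)

term≤sum : ∀ {n} (f : Fin n → ℕ) i → f i ≤ sum f
term≤sum f zero = m≤m+n _ _
term≤sum f (suc i) = ≤-trans (term≤sum (f ∘ suc) i) (m≤n+m _ (f zero))

sum-zero : ∀ {n} {f : Fin n → ℕ} → (∀ i → f i ≡ 0) → sum f ≡ 0
sum-zero {n} p = trans (sum-cong-≗ p) (trans (sum-const n 0) (*-zeroʳ n))

𝟙 : Bool → ℕ
𝟙 true = 1
𝟙 false = 0

𝟙≤1 : ∀ b → 𝟙 b ≤ 1
𝟙≤1 true = ≤-refl
𝟙≤1 false = z≤n

_==_ : ∀ {n} → Fin n → Fin n → Bool
u == v = does (u F.≟ v)

δ : ∀ {n} → Fin n → Fin n → ℕ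
δ u v = 𝟙 (u == v)

δ-refl : ∀ {n} (u : Fin n) → δ u u ≡ 1
δ-refl u with u F.≟ u
... | yes _ = refl
... | no ¬p = ⊥-elim (¬p refl)

δ-≢ : ∀ {n} {u v : Fin n} → u ≢ v → δ u v ≡ 0
δ-≢ {u = u} {v} ¬p with u F.≟ v
... | yes p = ⊥-elim (¬p p)
... | no _ = refl

δ-sym : ∀ {n} (i j : Fin n) → δ i j ≡ δ j i
δ-sym i j with i F.≟ j
... | yes refl = sym (δ-refl i)
... | no p = sym (δ-≢ (p ∘ sym))

sum-δ : ∀ {n} (u : Fin n) (g : Fin n → ℕ) → ∑[ v < n ] (δ u v * g v) ≡ g u
sum-δ {suc n} zero g = trans (cong₂ _+_ (+-identityʳ (g zero)) (sum-zero {n} λ i → refl)) (+-identityʳ _)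
sum-δ {suc n} (suc u) g = sum-δ u (g ∘ suc)

-- The term `a` on the right stands for the index `b`, so that n * a can be written in place of (n -
-- 1) * a.
sum-off : ∀ {n} (f : Fin n → ℕ) a b → (∀ i → i ≢ b → a ≤ f i) → n * a + f b ≤ sum f + a
sum-off {n} f a b p = begin
  n * a + f b                                  ≡⟨ cong₂ _+_ (sum-const n a) (sum-δ b f) ⟨
  ∑[ i < n ] a + ∑[ i < n ] (δ b i * f i)      ≡⟨ ∑-distrib-+ {n} (λ _ → a) (λ i → δ b i * f i) ⟨
  ∑[ i < n ] (a + δ b i * f i)                 ≤⟨ sum-mono q ⟩
  ∑[ i < n ] (f i + δ b i * a)                 ≡⟨ ∑-distrib-+ {n} f (λ i → δ b i * a) ⟩
  sum f + ∑[ i < n ] (δ b i * a)               ≡⟨ cong (sum f +_) (sum-δ b (λ _ → a)) ⟩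
  sum f + a                                    ∎
  where
  open ≤-Reasoning
  q : ∀ i → a + δ b i * f i ≤ f i + δ b i * a
  q i with b F.≟ i
  ... | yes refl = ≤-reflexive (trans (cong (a +_) (*-identityˡ _)) (trans (+-comm a _) (cong (f i +_) (sym (*-identityˡ a)))))
  ... | no ¬p = +-monoˡ-≤ 0 (p i (¬p ∘ sym))

-- Components and augmentation of matchings

module _ {N k : ℕ} (G : ColouredGraph N k) (i : Fin k) where

  Conn-trans : ∀ {u v w} → Conn G i u v → Conn G i v w → Conn G i u w
  Conn-trans here q = q
  Conn-trans (step e p) q = step e (Conn-trans p q)

  Conn-sym : ∀ {u v} → Conn G i u v → Conn G i v u
  Conn-sym here = here
  Conn-sym (step {u} {v} e p) = Conn-trans (Conn-sym p) (step (trans (symmetric G v u) e) here)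

  -- Invariant of a union-find pass over the pairs `es`: edges processed so far are respected, and
  -- equal labels never join different components. Once all pairs are processed, the labels are
  -- exactly the components.
  record Labelling (es : List (Fin N × Fin N)) : Set where
    field
      label     : Fin N → Fin N
      edge⇒same : ∀ {u v} → (u , v) ∈ es → col G u v ≡ just i → label u ≡ label v
      same⇒conn : ∀ u v → label u ≡ label v → Conn G i u v

  labelling : ∀ es → Labelling es
  labelling [] = record { label = id ; edge⇒same = λ () ; same⇒conn = λ { u .u refl → here } }
  labelling ((a , b) ∷ es) with labelling es | Maybe.≡-dec F._≟_ (col G a b) (just i)
  ... | L | no ¬e = record
    { label = label
    ; edge⇒same = λ { (here refl) e → ⊥-elim (¬e e) ; (there p) e → edge⇒same p e }
    ; same⇒conn = same⇒conn }
    where open Labelling L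
  ... | L | yes e = record { label = merged ; edge⇒same = edge ; same⇒conn = conn }
    where
    open Labelling L
    merged : Fin N → Fin N
    merged w with label w F.≟ label a
    ... | yes _ = label b
    ... | no _ = label w
    merged-cong : ∀ {u v} → label u ≡ label v → merged u ≡ merged v
    merged-cong {u} {v} q with label u F.≟ label a | label v F.≟ label a
    ... | yes _ | yes _ = refl
    ... | yes p | no ¬p = ⊥-elim (¬p (trans (sym q) p))
    ... | no ¬p | yes p = ⊥-elim (¬p (trans q p))
    ... | no _ | no _ = q
    merged-a : merged a ≡ label b
    merged-a with label a F.≟ label a
    ... | yes _ = refl
    ... | no ¬p = ⊥-elim (¬p refl)
    merged-b : merged b ≡ label b
    merged-b with label b F.≟ label a
    ... | yes _ = refl
    ... | no _ = refl
    edge : ∀ {u v} → (u , v) ∈ (a , b) ∷ es → col G u v ≡ just i → merged u ≡ merged v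
    edge (here refl) _ = trans merged-a (sym merged-b)
    edge (there p) e′ = merged-cong (edge⇒same p e′)
    to-b : ∀ u → label u ≡ label a → Conn G i u b
    to-b u p = Conn-trans (same⇒conn u a p) (step e here)
    conn : ∀ u v → merged u ≡ merged v → Conn G i u v
    conn u v q with label u F.≟ label a | label v F.≟ label a
    ... | yes p | yes p′ = same⇒conn u v (trans p (sym p′))
    ... | yes p | no _ = Conn-trans (to-b u p) (same⇒conn b v q)
    ... | no _ | yes p = Conn-sym (Conn-trans (to-b v p) (same⇒conn b u (sym q)))
    ... | no _ | no _ = same⇒conn u v q

  private module L = Labelling (labelling (cartesianProduct (allFin N) (allFin N)))

  component : Fin N → Fin N
  component = L.label

  component-edge : ∀ {u v} → col G u v ≡ just i → component u ≡ component v
  component-edge {u} {v} = L.edge⇒same (∈-cartesianProduct⁺ (∈-allFin u) (∈-allFin v))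

  component-conn : ∀ u v → component u ≡ component v → Conn G i u v
  component-conn = L.same⇒conn

anyBool? : {P : Bool → Set} → (∀ b → Dec (P b)) → Dec (∃ P)
anyBool? P? with P? true | P? false
... | yes p | _ = yes (true , p)
... | no _ | yes p = yes (false , p)
... | no ¬p | no ¬q = no λ { (true , p) → ¬p p ; (false , q) → ¬q q }

allFin-⊎ : ∀ {n} {A : Set} {B : Fin n → Set} → (∀ i → A ⊎ B i) → A ⊎ (∀ i → B i)
allFin-⊎ {zero} p = inj₂ λ ()
allFin-⊎ {suc n} p with p zero | allFin-⊎ (p ∘ suc)
... | inj₁ a | _ = inj₁ a
... | inj₂ _ | inj₁ a = inj₁ a
... | inj₂ b | inj₂ bs = inj₂ λ { zero → b ; (suc i) → bs i }

module Matchings {N : ℕ} (A : Fin N → Fin N → Bool) (A-sym : ∀ u v → A u v ≡ A v u) where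

  -- Ends are indexed by `Bool`, so that `not b` names the partner of the end `b` and both
  -- orientations of an edge are treated alike.
  record Matching (t : ℕ) : Set where
    field
      end   : Fin t → Bool → Fin N
      inj   : ∀ j b j′ b′ → end j b ≡ end j′ b′ → j ≡ j′ × b ≡ b′
      edge  : ∀ j → A (end j true) (end j false) ≡ true
  open Matching public

  Free : ∀ {t} → Matching t → Fin N → Set
  Free M v = ∀ j b → end M j b ≢ v

  matched? : ∀ {t} (M : Matching t) v → Dec (∃₂ λ j b → end M j b ≡ v)
  matched? M v = F.any? λ j → anyBool? λ b → end M j b F.≟ v

  free? : ∀ {t} (M : Matching t) v → Dec (Free M v)
  free? M v = map′ (λ ¬p j b q → ¬p (j , b , q)) (λ p (j , b , q) → p j b q) (¬? (matched? M v))

  edge′ : ∀ {t} (M : Matching t) j b → A (end M j b) (end M j (not b)) ≡ true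
  edge′ M j true = edge M j
  edge′ M j false = trans (A-sym _ _) (edge M j)

  empty : Matching 0
  empty = record { end = λ () ; inj = λ () ; edge = λ () }

  add : ∀ {t} (M : Matching t) {u v} → Free M u → Free M v → u ≢ v → A u v ≡ true → Matching (suc t)
  add {t} M {u} {v} fu fv u≢v e = record { end = end₁ ; inj = inj₁′ ; edge = λ { zero → e ; (suc j) → edge M j } }
    where
    end₁ : Fin (suc t) → Bool → Fin N
    end₁ zero true = u
    end₁ zero false = v
    end₁ (suc j) b = end M j b
    inj₁′ : ∀ j b j′ b′ → end₁ j b ≡ end₁ j′ b′ → j ≡ j′ × b ≡ b′
    inj₁′ zero true zero true q = refl , refl
    inj₁′ zero true zero false q = ⊥-elim (u≢v q)
    inj₁′ zero false zero true q = ⊥-elim (u≢v (sym q))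
    inj₁′ zero false zero false q = refl , refl
    inj₁′ zero true (suc j) b q = ⊥-elim (fu j b (sym q))
    inj₁′ zero false (suc j) b q = ⊥-elim (fv j b (sym q))
    inj₁′ (suc j) b zero true q = ⊥-elim (fu j b q)
    inj₁′ (suc j) b zero false q = ⊥-elim (fv j b q)
    inj₁′ (suc j) b (suc j′) b′ q = map₁ (cong suc) (inj M j b j′ b′ q)

  -- One step along an alternating path: the edge `j₀` is replaced by the edge from its end `b₀` to
  -- the free vertex `u`, which frees its other end. An augmenting path thereby becomes shorter by
  -- two edges.
  module Rotate {t} (M : Matching t) (j₀ : Fin t) (b₀ : Bool) {u} (fu : Free M u) (e : A (end M j₀ b₀) u ≡ true) where

    moved? : ∀ j b → Dec (j ≡ j₀ × b ≡ not b₀)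
    moved? j b = j F.≟ j₀ ×-dec b B.≟ not b₀

    rend : Fin t → Bool → Fin N
    rend j b with moved? j b
    ... | yes _ = u
    ... | no _ = end M j b

    rend-other : ∀ {j} b → j ≢ j₀ → rend j b ≡ end M j b
    rend-other {j} b j≢ with moved? j b
    ... | yes (p , _) = ⊥-elim (j≢ p)
    ... | no _ = refl

    rend-kept : rend j₀ b₀ ≡ end M j₀ b₀
    rend-kept with moved? j₀ b₀
    ... | yes (_ , q) = ⊥-elim (B.not-¬ refl q)
    ... | no _ = refl

    rend-moved : rend j₀ (not b₀) ≡ u
    rend-moved with moved? j₀ (not b₀)
    ... | yes _ = refl
    ... | no ¬p = ⊥-elim (¬p (refl , refl))

    rinj : ∀ j b j′ b′ → rend j b ≡ rend j′ b′ → j ≡ j′ × b ≡ b′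
    rinj j b j′ b′ q with moved? j b | moved? j′ b′
    ... | yes (refl , refl) | yes (refl , refl) = refl , refl
    ... | yes _ | no _ = ⊥-elim (fu j′ b′ (sym q))
    ... | no _ | yes _ = ⊥-elim (fu j b q)
    ... | no _ | no _ = inj M j b j′ b′ q

    redge-at : ∀ b → Dec (b ≡ b₀) → A (rend j₀ b) (rend j₀ (not b)) ≡ true
    redge-at b (yes refl) = trans (cong₂ A rend-kept rend-moved) e
    redge-at b (no b≢) with B.¬-not b≢
    ... | refl = trans (A-sym _ _) (trans (cong₂ A (trans (cong (rend j₀) (B.not-involutive b₀)) rend-kept) rend-moved) e)

    redge-dec : ∀ j → Dec (j ≡ j₀) → A (rend j true) (rend j false) ≡ true
    redge-dec j (yes refl) = redge-at true (true B.≟ b₀)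
    redge-dec j (no j≢) = trans (cong₂ A (rend-other true j≢) (rend-other false j≢)) (edge M j)

    redge : ∀ j → A (rend j true) (rend j false) ≡ true
    redge j = redge-dec j (j F.≟ j₀)

    rotated : Matching t
    rotated = record { end = rend ; inj = rinj ; edge = redge }

    freed : Free rotated (end M j₀ (not b₀))
    freed j b q with moved? j b
    ... | yes _ = fu j₀ (not b₀) (sym q)
    ... | no ¬p = ¬p (inj M j b j₀ (not b₀) q)

    still-free : ∀ {v} → Free M v → u ≢ v → Free rotated v
    still-free fv u≢v j b q with moved? j b
    ... | yes _ = u≢v q
    ... | no _ = fv j b q

  -- Augmenting paths with 1, 3 and 5 edges. Excluding the first makes the unmatched vertices
  -- independent, the second separates the partner of a hub from them, the third makes these
  -- partners independent.
  Aug₁ Aug₃ Aug₅ : ∀ {t} → Matching t → Set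
  Aug₁ M = ∃₂ λ u v → Free M u × Free M v × u ≢ v × A u v ≡ true
  Aug₃ M = ∃₂ λ j b → ∃₂ λ u v → Free M u × Free M v × u ≢ v ×
    A (end M j b) u ≡ true × A (end M j (not b)) v ≡ true
  Aug₅ M = ∃₂ λ j b → ∃₂ λ j′ b′ → ∃₂ λ u v → Free M u × Free M v × u ≢ v × j ≢ j′ ×
    A (end M j b) u ≡ true × A (end M j′ b′) v ≡ true × A (end M j (not b)) (end M j′ (not b′)) ≡ true

  aug₁? : ∀ {t} (M : Matching t) → Dec (Aug₁ M)
  aug₁? M = F.any? λ u → F.any? λ v → free? M u ×-dec free? M v ×-dec ¬? (u F.≟ v) ×-dec A u v B.≟ true

  aug₃? : ∀ {t} (M : Matching t) → Dec (Aug₃ M)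
  aug₃? M = F.any? λ j → anyBool? λ b → F.any? λ u → F.any? λ v →
    free? M u ×-dec free? M v ×-dec ¬? (u F.≟ v) ×-dec
    A (end M j b) u B.≟ true ×-dec A (end M j (not b)) v B.≟ true

  aug₅? : ∀ {t} (M : Matching t) → Dec (Aug₅ M)
  aug₅? M = F.any? λ j → anyBool? λ b → F.any? λ j′ → anyBool? λ b′ → F.any? λ u → F.any? λ v →
    free? M u ×-dec free? M v ×-dec ¬? (u F.≟ v) ×-dec ¬? (j F.≟ j′) ×-dec
    A (end M j b) u B.≟ true ×-dec A (end M j′ b′) v B.≟ true ×-dec A (end M j (not b)) (end M j′ (not b′)) B.≟ true

  augment₃ : ∀ {t} (M : Matching t) → Aug₃ M → Matching (suc t)
  augment₃ M (j , b , u , v , fu , fv , u≢v , e , e′) =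
    add rotated freed (still-free fv u≢v) (fv j (not b)) e′
    where open Rotate M j b fu e

  -- Rotating both matching edges outwards, onto `u` and onto `v`, frees the two inner vertices of
  -- the path, which `e″` joins. The edge `j′` is untouched by the first rotation, hence the
  -- transports along `rend-other`.
  augment₅ : ∀ {t} (M : Matching t) → Aug₅ M → Matching (suc t)
  augment₅ M (j , b , j′ , b′ , u , v , fu , fv , u≢v , j≢j′ , e , e′ , e″) =
    add R₂.rotated (R₂.still-free R₁.freed (fv j (not b) ∘ sym))
      (subst (Free R₂.rotated) (R₁.rend-other (not b′) (j≢j′ ∘ sym)) R₂.freed)
      (λ q → j≢j′ (proj₁ (inj M j (not b) j′ (not b′) q))) e″
    where
    module R₁ = Rotate M j b fu e
    module R₂ = Rotate R₁.rotated j′ b′ (R₁.still-free fv u≢v) (trans (cong (λ x → A x v) (R₁.rend-other b′ (j≢j′ ∘ sym))) e′)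

  record Stuck : Set where
    field
      {size} : ℕ
      M     : Matching size
      ¬aug₁ : ¬ Aug₁ M
      ¬aug₃ : ¬ Aug₃ M
      ¬aug₅ : ¬ Aug₅ M

  -- The number `s` of augmentations still wanted is also the recursion measure, so a search that
  -- gets stuck ends below the target size.
  search : ∀ s {t} → Matching t → Matching (s + t) ⊎ Σ Stuck λ S → Stuck.size S < s + t
  search zero M = inj₁ M
  search (suc s) {t} M with aug₁? M | aug₃? M | aug₅? M
  ... | yes (u , v , fu , fv , u≢v , e) | _ | _ = subst (λ x → Matching x ⊎ Σ Stuck λ S → Stuck.size S < x) (+-suc s t) (search s (add M fu fv u≢v e))
  ... | no _ | yes a | _ = subst (λ x → Matching x ⊎ Σ Stuck λ S → Stuck.size S < x) (+-suc s t) (search s (augment₃ M a))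
  ... | no _ | no _ | yes a = subst (λ x → Matching x ⊎ Σ Stuck λ S → Stuck.size S < x) (+-suc s t) (search s (augment₅ M a))
  ... | no p | no q | no r = inj₂ (record { M = M ; ¬aug₁ = p ; ¬aug₃ = q ; ¬aug₅ = r } , s≤s (m≤n+m t s))

  matching-or-stuck : ∀ m → Matching m ⊎ Σ Stuck λ S → Stuck.size S < m
  matching-or-stuck m = subst (λ x → Matching x ⊎ Σ Stuck λ S → Stuck.size S < x) (+-identityʳ m) (search m empty)

-- Indicator sums over pairs and images

count : ∀ {n} → (Fin n → Bool) → ℕ
count P = sum (𝟙 ∘ P)

sum₂-distrib-+ : ∀ {n p} (f g : Fin n → Fin p → ℕ) →
  ∑[ u < n ] ∑[ v < p ] (f u v + g u v) ≡ ∑[ u < n ] ∑[ v < p ] f u v + ∑[ u < n ] ∑[ v < p ] g u v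
sum₂-distrib-+ {n} {p} f g = trans (sum-cong-≗ λ u → ∑-distrib-+ (f u) (g u)) (∑-distrib-+ (sum ∘ f) (sum ∘ g))

sum-product : ∀ {n p} (f : Fin n → ℕ) (g : Fin p → ℕ) → ∑[ u < n ] ∑[ v < p ] (f u * g v) ≡ sum f * sum g
sum-product f g = trans (sum-cong-≗ λ u → sym (*-distribˡ-sum (f u) g)) (sym (*-distribʳ-sum (sum g) f))

sum-diagonal : ∀ {n} (f : Fin n → ℕ) → ∑[ u < n ] ∑[ v < n ] (δ u v * f u) ≡ sum f
sum-diagonal f = sum-cong-≗ λ u → sum-δ u (λ _ → f u)

module Image {t N : ℕ} (on : Fin t → Bool) (e : Fin t → Fin N) (e-inj : ∀ i j → e i ≡ e j → i ≡ j) where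

  image? : ∀ v → Dec (∃ λ j → on j ≡ true × e j ≡ v)
  image? v = F.any? λ j → on j B.≟ true ×-dec e j F.≟ v

  image : Fin N → Bool
  image v = does (image? v)

  𝟙-image : ∀ v → 𝟙 (image v) ≡ ∑[ j < t ] (𝟙 (on j) * δ (e j) v)
  𝟙-image v with image? v
  ... | no ¬p = sym (sum-zero z)
    where
    z : ∀ j → 𝟙 (on j) * δ (e j) v ≡ 0
    z j with on j in eq | e j F.≟ v
    ... | false | _ = refl
    ... | true | yes q = ⊥-elim (¬p (j , eq , q))
    ... | true | no _ = refl
  ... | yes (i , oni , refl) = sym (trans (sum-cong-≗ z) (trans (sum-δ i (𝟙 ∘ on)) (cong 𝟙 oni)))
    where
    z : ∀ j → 𝟙 (on j) * δ (e j) (e i) ≡ δ i j * 𝟙 (on j)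
    z j with i F.≟ j
    ... | yes refl = trans (cong (𝟙 (on j) *_) (δ-refl (e j))) (trans (*-identityʳ (𝟙 (on j))) (sym (*-identityˡ (𝟙 (on j)))))
    ... | no i≢j = trans (cong (𝟙 (on j) *_) (δ-≢ (i≢j ∘ sym ∘ e-inj j i))) (*-zeroʳ (𝟙 (on j)))

  sum-image : ∀ g → ∑[ v < N ] (𝟙 (image v) * g v) ≡ ∑[ j < t ] (𝟙 (on j) * g (e j))
  sum-image g = begin
    ∑[ v < N ] (𝟙 (image v) * g v)                              ≡⟨ sum-cong-≗ (λ v → trans (cong (_* g v) (𝟙-image v)) (*-distribʳ-sum (g v) (λ j → 𝟙 (on j) * δ (e j) v))) ⟩
    ∑[ v < N ] ∑[ j < t ] (𝟙 (on j) * δ (e j) v * g v)          ≡⟨ ∑-comm (λ v j → 𝟙 (on j) * δ (e j) v * g v) ⟩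
    ∑[ j < t ] ∑[ v < N ] (𝟙 (on j) * δ (e j) v * g v)          ≡⟨ sum-cong-≗ (λ j → trans (sum-cong-≗ λ v → *-assoc (𝟙 (on j)) (δ (e j) v) (g v)) (sym (*-distribˡ-sum (𝟙 (on j)) (λ v → δ (e j) v * g v)))) ⟩
    ∑[ j < t ] (𝟙 (on j) * ∑[ v < N ] (δ (e j) v * g v))        ≡⟨ sum-cong-≗ (λ j → cong (𝟙 (on j) *_) (sum-δ (e j) g)) ⟩
    ∑[ j < t ] (𝟙 (on j) * g (e j))                             ∎
    where open ≡-Reasoning

  count-image : count image ≡ count on
  count-image = trans (sum-cong-≗ λ v → sym (*-identityʳ (𝟙 (image v)))) (trans (sum-image (λ _ → 1)) (sum-cong-≗ λ j → *-identityʳ (𝟙 (on j))))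

-- The load of a class with a stuck matching

module Class {N : ℕ} (C : Fin N → Bool) (A : Fin N → Fin N → Bool)
  (A-sym : ∀ u v → A u v ≡ A v u) (A-irrefl : ∀ u → A u u ≡ false)
  (A⊆C : ∀ u v → A u v ≡ true → C u ≡ true) where

  open Matchings A A-sym

  A⇒≢ : ∀ {u v} → A u v ≡ true → u ≢ v
  A⇒≢ {u} e refl = case trans (sym e) (A-irrefl u) of λ ()

  -- The core of a class is treated as a clique and its other vertices as singletons; the edges
  -- that this misses are counted individually.
  together extra : (core : Fin N → Bool) → Fin N → Fin N → ℕ
  together core u v = 𝟙 (C u) * 𝟙 ((u == v) ∨ (core u ∧ core v))
  extra core u v = 𝟙 (A u v ∧ not (core u ∧ core v))

  load : (core : Fin N → Bool) → ℕ
  load core = ∑[ u < N ] ∑[ v < N ] (together core u v + extra core u v)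

  _⊆C : (Fin N → Bool) → Set
  core ⊆C = ∀ v → core v ≡ true → C v ≡ true

  -- All charged pairs lie in C × C, and none is charged twice: `extra` counts neither loops nor
  -- pairs inside the core.
  load≤square : ∀ core → core ⊆C → load core ≤ count C * count C
  load≤square core core⊆ = ≤-trans (sum-mono λ u → sum-mono (pw u)) (≤-reflexive (sum-product (𝟙 ∘ C) (𝟙 ∘ C)))
    where
    pw : ∀ u v → together core u v + extra core u v ≤ 𝟙 (C u) * 𝟙 (C v)
    pw u v with C u in cu | A u v in a
    ... | false | true = case trans (sym (A⊆C u v a)) cu of λ ()
    ... | false | false = z≤n
    ... | true | a′ with C v in cv | u F.≟ v | core u | core v in kv
    pw u v | true | true | false | _ | _ | _ = case trans (sym (A⊆C v u (trans (A-sym v u) a))) cv of λ ()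
    pw u v | true | false | false | yes refl | _ | _ = case trans (sym cv) cu of λ ()
    pw u v | true | false | false | no _ | true | true = case trans (sym (core⊆ v kv)) cv of λ ()
    pw u v | true | false | false | no _ | true | false = z≤n
    pw u v | true | false | false | no _ | false | _ = z≤n
    pw u v | true | false | true | yes _ | _ | _ = ≤-refl
    pw u v | true | false | true | no _ | true | true = ≤-refl
    pw u v | true | false | true | no _ | true | false = z≤n
    pw u v | true | false | true | no _ | false | _ = z≤n
    pw u v | true | true | true | yes p | _ | _ = ⊥-elim (A⇒≢ a p)
    pw u v | true | true | true | no _ | true | true = ≤-refl
    pw u v | true | true | true | no _ | true | false = ≤-refl
    pw u v | true | true | true | no _ | false | _ = ≤-refl

  module _ (S : Stuck) where
    open Stuck S renaming (size to t)

    matched unmatched : Fin N → Bool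
    matched v = does (matched? M v)
    unmatched v = C v ∧ not (matched v)

    matched⊆C : matched ⊆C
    matched⊆C v p with matched? M v
    matched⊆C v p | yes (j , b , refl) = A⊆C _ _ (edge′ M j b)

    private
      side : Bool → Fin t → Fin N
      side b j = end M j b

      side-inj : ∀ b i j → side b i ≡ side b j → i ≡ j
      side-inj b i j q = proj₁ (inj M i b j b q)

      module I b = Image {t} {N} (λ _ → true) (side b) (side-inj b)

    𝟙-matched : ∀ v → 𝟙 (matched v) ≡ 𝟙 (I.image true v) + 𝟙 (I.image false v)
    𝟙-matched v with matched? M v | I.image? true v | I.image? false v
    ... | _ | yes (i , _ , p) | yes (j , _ , q) = case proj₂ (inj M i true j false (trans p (sym q))) of λ ()
    ... | yes _ | yes _ | no _ = refl
    ... | yes _ | no _ | yes _ = refl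
    ... | yes (j , true , p) | no ¬p | no _ = ⊥-elim (¬p (j , refl , p))
    ... | yes (j , false , p) | no _ | no ¬p = ⊥-elim (¬p (j , refl , p))
    ... | no ¬p | yes (j , _ , q) | no _ = ⊥-elim (¬p (j , true , q))
    ... | no ¬p | no _ | yes (j , _ , q) = ⊥-elim (¬p (j , false , q))
    ... | no _ | no _ | no _ = refl

    sum-matched : ∀ g → ∑[ v < N ] (𝟙 (matched v) * g v) ≡ ∑[ j < t ] (g (end M j true) + g (end M j false))
    sum-matched g = begin
      ∑[ v < N ] (𝟙 (matched v) * g v)
        ≡⟨ sum-cong-≗ (λ v → trans (cong (_* g v) (𝟙-matched v)) (*-distribʳ-+ (g v) (𝟙 (I.image true v)) (𝟙 (I.image false v)))) ⟩
      ∑[ v < N ] (𝟙 (I.image true v) * g v + 𝟙 (I.image false v) * g v)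
        ≡⟨ ∑-distrib-+ (λ v → 𝟙 (I.image true v) * g v) (λ v → 𝟙 (I.image false v) * g v) ⟩
      ∑[ v < N ] (𝟙 (I.image true v) * g v) + ∑[ v < N ] (𝟙 (I.image false v) * g v)
        ≡⟨ cong₂ _+_ (one true) (one false) ⟩
      ∑[ j < t ] g (end M j true) + ∑[ j < t ] g (end M j false)
        ≡⟨ ∑-distrib-+ (g ∘ side true) (g ∘ side false) ⟨
      ∑[ j < t ] (g (end M j true) + g (end M j false)) ∎
      where
      open ≡-Reasoning
      one : ∀ b → ∑[ v < N ] (𝟙 (I.image b v) * g v) ≡ ∑[ j < t ] g (end M j b)
      one b = trans (I.sum-image b g) (sum-cong-≗ λ j → *-identityˡ (g (end M j b)))

    count-matched : count matched ≡ 2 * t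
    count-matched = trans (sum-cong-≗ λ v → sym (*-identityʳ (𝟙 (matched v))))
      (trans (sum-matched (λ _ → 1)) (trans (sum-const t 2) (*-comm t 2)))

    U : ℕ
    U = count unmatched

    count-C : count C ≡ 2 * t + U
    count-C = trans (sum-cong-≗ split) (trans (∑-distrib-+ (𝟙 ∘ matched) (𝟙 ∘ unmatched)) (cong (_+ U) count-matched))
      where
      split : ∀ v → 𝟙 (C v) ≡ 𝟙 (matched v) + 𝟙 (unmatched v)
      split v with matched v in mv | C v in cv
      ... | true | true = refl
      ... | true | false = case trans (sym (matched⊆C v mv)) cv of λ ()
      ... | false | true = refl
      ... | false | false = refl

    free-unmatched : ∀ {v} → unmatched v ≡ true → Free M v
    free-unmatched {v} p with C v | matched? M v
    ... | true | no ¬p = λ j b q → ¬p (j , b , q)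

    udeg : Fin N → ℕ
    udeg v = ∑[ w < N ] (𝟙 (unmatched w) * 𝟙 (A v w))

    udeg≤U : ∀ v → udeg v ≤ U
    udeg≤U v = sum-mono λ w → ≤-trans (*-monoʳ-≤ (𝟙 (unmatched w)) (𝟙≤1 (A v w))) (≤-reflexive (*-identityʳ (𝟙 (unmatched w))))

    -- Supplies the distinct free end vertices that an augmenting path needs.
    two-neighbours : ∀ {x} → 2 ≤ udeg x → ∀ w → ∃ λ u → Free M u × u ≢ w × A x u ≡ true
    two-neighbours {x} 2≤ w with F.any? (λ u → free? M u ×-dec ¬? (u F.≟ w) ×-dec A x u B.≟ true)
    ... | yes p = p
    ... | no ¬p = ⊥-elim (<⇒≱ 2≤ (≤-trans (sum-mono pw) (≤-reflexive (sum-δ w (λ _ → 1)))))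
      where
      pw : ∀ u → 𝟙 (unmatched u) * 𝟙 (A x u) ≤ δ w u * 1
      pw u with unmatched u in fu | A x u in e | w F.≟ u
      ... | false | _ | _ = z≤n
      ... | true | false | _ = z≤n
      ... | true | true | yes _ = ≤-refl
      ... | true | true | no w≢u = ⊥-elim (¬p (u , free-unmatched fu , (w≢u ∘ sym) , e))

    -- An edge with an end seeing two unmatched vertices is heavy: its other end then sees none,
    -- and these other ends are pairwise non-adjacent.
    heavy? : ∀ j → Dec (∃ λ b → 2 ≤ udeg (end M j b))
    heavy? j = anyBool? λ b → 2 ≤? udeg (end M j b)

    isHeavy : Fin t → Bool
    isHeavy j = does (heavy? j)

    top : Fin t → Bool
    top j = pick (heavy? j)
      where
      pick : ∀ {P : Bool → Set} → Dec (∃ P) → Bool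
      pick (yes (b , _)) = b
      -- Arbitrary; the choice of an end matters only on heavy edges.
      pick (no _) = true

    2≤top : ∀ j → isHeavy j ≡ true → 2 ≤ udeg (end M j (top j))
    2≤top j p with heavy? j
    ... | yes (_ , q) = q

    bottom : Fin t → Fin N
    bottom j = end M j (not (top j))

    -- An unmatched neighbour `w` of the bottom, together with an unmatched neighbour of the top
    -- other than `w`, gives an augmenting path of length 3.
    bottom-udeg : ∀ j → isHeavy j ≡ true → udeg (bottom j) ≡ 0
    bottom-udeg j p = sum-zero z
      where
      z : ∀ w → 𝟙 (unmatched w) * 𝟙 (A (bottom j) w) ≡ 0
      z w with unmatched w in fw | A (bottom j) w in e
      ... | false | _ = refl
      ... | true | false = refl
      ... | true | true with two-neighbours (2≤top j p) w
      ... | u , fu , u≢w , e′ = ⊥-elim (¬aug₃ (j , top j , u , w , fu , free-unmatched fw , u≢w , e′ , e))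

    -- Adjacent bottoms, their tops, and distinct unmatched neighbours of these tops form an
    -- augmenting path of length 5.
    bottoms-independent : ∀ i j → isHeavy i ≡ true → isHeavy j ≡ true → A (bottom i) (bottom j) ≡ false
    bottoms-independent i j p q with A (bottom i) (bottom j) in e
    ... | false = refl
    ... | true with two-neighbours (2≤top i p) (bottom i)
    ... | u , fu , _ , eu with two-neighbours (2≤top j q) u
    ... | v , fv , v≢u , ev = ⊥-elim (¬aug₅ (i , top i , j , top j , u , v , fu , fv , (v≢u ∘ sym) ,
            (λ i≡j → A⇒≢ e (cong bottom i≡j)) , eu , ev , e))

    h l : ℕ
    h = count isHeavy
    l = count (not ∘ isHeavy)

    h+l≡t : h + l ≡ t
    h+l≡t = trans (sym (∑-distrib-+ (𝟙 ∘ isHeavy) (𝟙 ∘ not ∘ isHeavy)))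
      (trans (sum-cong-≗ (λ j → one (isHeavy j))) (trans (sum-const t 1) (*-identityʳ t)))
      where
      one : ∀ b → 𝟙 b + 𝟙 (not b) ≡ 1
      one true = refl
      one false = refl

    crossing : ℕ
    crossing = ∑[ v < N ] (𝟙 (matched v) * udeg v)

    -- A heavy edge reaches unmatched vertices only from its top; a light edge reaches at most one
    -- from each end.
    crossing≤ : crossing ≤ h * U + l * 2
    crossing≤ = begin
      crossing                                                             ≡⟨ sum-matched udeg ⟩
      ∑[ j < t ] (udeg (end M j true) + udeg (end M j false))              ≤⟨ sum-mono pw ⟩
      ∑[ j < t ] (𝟙 (isHeavy j) * U + 𝟙 (not (isHeavy j)) * 2)             ≡⟨ ∑-distrib-+ (λ j → 𝟙 (isHeavy j) * U) (λ j → 𝟙 (not (isHeavy j)) * 2) ⟩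
      ∑[ j < t ] (𝟙 (isHeavy j) * U) + ∑[ j < t ] (𝟙 (not (isHeavy j)) * 2) ≡⟨ cong₂ _+_ (*-distribʳ-sum U (𝟙 ∘ isHeavy)) (*-distribʳ-sum 2 (𝟙 ∘ not ∘ isHeavy)) ⟨
      h * U + l * 2                                                        ∎
      where
      open ≤-Reasoning
      reorder : ∀ j b → udeg (end M j true) + udeg (end M j false) ≡ udeg (end M j b) + udeg (end M j (not b))
      reorder j true = refl
      reorder j false = +-comm (udeg (end M j true)) _
      pw : ∀ j → udeg (end M j true) + udeg (end M j false) ≤ 𝟙 (isHeavy j) * U + 𝟙 (not (isHeavy j)) * 2
      pw j with isHeavy j in eq
      ... | true = begin
        udeg (end M j true) + udeg (end M j false)   ≡⟨ reorder j (top j) ⟩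
        udeg (end M j (top j)) + udeg (bottom j)     ≡⟨ cong (udeg (end M j (top j)) +_) (bottom-udeg j eq) ⟩
        udeg (end M j (top j)) + 0                   ≤⟨ +-monoˡ-≤ 0 (udeg≤U (end M j (top j))) ⟩
        U + 0                                        ≡⟨ +-identityʳ (U + 0) ⟨
        U + 0 + 0                                    ∎
      ... | false = +-mono-≤ (small true) (small false)
        where
        small : ∀ b → udeg (end M j b) ≤ 1
        small b = ≤-pred (≰⇒> λ q → case trans (sym (dec-true (heavy? j) (b , q))) eq of λ ())

    module Top = Image isHeavy (λ j → end M j (top j)) (λ i j q → proj₁ (inj M i (top i) j (top j) q))
    module Bottom = Image isHeavy bottom (λ i j q → proj₁ (inj M i (not (top i)) j (not (top j)) q))

    loose : Fin N → Bool
    loose = Bottom.image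

    -- Moving the h bottoms out of the core saves the h * h pairs among them, which are independent,
    -- at the price of h diagonal pairs. All hubs stay in the core.
    reducedCore : Fin N → Bool
    reducedCore v = matched v ∧ not (loose v)

    reducedCore⊆C : reducedCore ⊆C
    reducedCore⊆C v p = matched⊆C v (B.∧-conicalˡ (matched v) _ p)

    loose⇒matched : ∀ v → loose v ≡ true → matched v ≡ true
    loose⇒matched v p with Bottom.image? v
    ... | yes (j , _ , q) = dec-true (matched? M v) (j , not (top j) , q)

    top⇒reducedCore : ∀ v → Top.image v ≡ true → reducedCore v ≡ true
    top⇒reducedCore v p with Top.image? v
    ... | yes (j , _ , q) = cong₂ (λ x y → x ∧ not y) (dec-true (matched? M v) (j , top j , q))
            (dec-false (Bottom.image? v) λ (j′ , _ , q′) → contra (inj M j (top j) j′ (not (top j′)) (trans q (sym q′))))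
      where
      contra : ∀ {j′} → j ≡ j′ × top j ≡ not (top j′) → ⊥
      contra (refl , r) = B.not-¬ refl r

    count-reducedCore : count reducedCore + h ≡ 2 * t
    count-reducedCore = trans (cong (count reducedCore +_) (sym Bottom.count-image))
      (trans (sym (∑-distrib-+ (𝟙 ∘ reducedCore) (𝟙 ∘ loose))) (trans (sum-cong-≗ split) count-matched))
      where
      split : ∀ v → 𝟙 (reducedCore v) + 𝟙 (loose v) ≡ 𝟙 (matched v)
      split v with loose v in lv | matched v in mv
      ... | true | true = refl
      ... | true | false = case trans (sym (loose⇒matched v lv)) mv of λ ()
      ... | false | true = refl
      ... | false | false = refl

    private
      across across′ : Fin N → Fin N → ℕ
      across u v = 𝟙 (matched u) * (𝟙 (unmatched v) * 𝟙 (A u v))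
      across′ u v = across v u

      sum-across : ∑[ u < N ] ∑[ v < N ] across u v ≡ crossing
      sum-across = sum-cong-≗ λ u → sym (*-distribˡ-sum (𝟙 (matched u)) (λ v → 𝟙 (unmatched v) * 𝟙 (A u v)))

      sum-across′ : ∑[ u < N ] ∑[ v < N ] across′ u v ≡ crossing
      sum-across′ = trans (∑-comm across′) sum-across

      sum-both : ∑[ u < N ] ∑[ v < N ] (across u v + across′ u v) ≤ 2 * (h * U + l * 2)
      sum-both = ≤-trans (≤-reflexive (trans (sum₂-distrib-+ across across′) (cong₂ _+_ sum-across sum-across′)))
        (≤-trans (+-mono-≤ crossing≤ crossing≤) (≤-reflexive (cong (h * U + l * 2 +_) (sym (+-identityʳ (h * U + l * 2))))))

      edge⇒some-matched : ∀ u v → A u v ≡ true → C u ≡ true × C v ≡ true × (matched u ≡ false → matched v ≡ false → ⊥)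
      edge⇒some-matched u v e = cu , cv , λ p q →
        ¬aug₁ (u , v , free-unmatched (cong₂ (λ x y → x ∧ not y) cu p) , free-unmatched (cong₂ (λ x y → x ∧ not y) cv q) , A⇒≢ e , e)
        where
        cu = A⊆C u v e
        cv = A⊆C v u (trans (A-sym v u) e)

      diag : ∀ {u v} (P : Fin N → Bool) → (u == v) ≡ true → P u ≡ P v
      diag {u} {v} P p with u F.≟ v
      ... | yes refl = refl

    -- The terms are the diagonal pairs of unmatched vertices, the pairs inside the core, and the
    -- edges between the two in both orders. Edges among unmatched vertices would be augmenting
    -- paths of length 1.
    load-matched : load matched ≤ U + 2 * t * (2 * t) + 2 * (h * U + l * 2)
    load-matched = begin
      load matched
        ≤⟨ sum-mono (λ u → sum-mono (pw u)) ⟩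
      ∑[ u < N ] ∑[ v < N ] (D u v + MM u v + (across u v + across′ u v))
        ≡⟨ sum₂-distrib-+ (λ u v → D u v + MM u v) (λ u v → across u v + across′ u v) ⟩
      ∑[ u < N ] ∑[ v < N ] (D u v + MM u v) + ∑[ u < N ] ∑[ v < N ] (across u v + across′ u v)
        ≤⟨ +-mono-≤ (≤-reflexive (sum₂-distrib-+ D MM)) sum-both ⟩
      ∑[ u < N ] ∑[ v < N ] D u v + ∑[ u < N ] ∑[ v < N ] MM u v + 2 * (h * U + l * 2)
        ≡⟨ cong (_+ 2 * (h * U + l * 2)) (cong₂ _+_ (sum-diagonal (𝟙 ∘ unmatched)) (trans (sum-product (𝟙 ∘ matched) (𝟙 ∘ matched)) (cong₂ _*_ count-matched count-matched))) ⟩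
      U + 2 * t * (2 * t) + 2 * (h * U + l * 2) ∎
      where
      open ≤-Reasoning
      D MM : Fin N → Fin N → ℕ
      D u v = δ u v * 𝟙 (unmatched u)
      MM u v = 𝟙 (matched u) * 𝟙 (matched v)
      bool₁ : ∀ c d x y → (d ≡ true → x ≡ y) → 𝟙 c * 𝟙 (d ∨ (x ∧ y)) ≤ 𝟙 d * 𝟙 (c ∧ not x) + 𝟙 x * 𝟙 y
      bool₁ false d x y p = z≤n
      bool₁ true true true true p = ≤-refl
      bool₁ true true true false p = case p refl of λ ()
      bool₁ true true false y p = ≤-refl
      bool₁ true false true true p = ≤-refl
      bool₁ true false true false p = z≤n
      bool₁ true false false y p = z≤n
      bool₂ : ∀ a c d x y → (a ≡ true → c ≡ true × d ≡ true × (x ≡ false → y ≡ false → ⊥)) →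
        𝟙 (a ∧ not (x ∧ y)) ≤ 𝟙 x * (𝟙 (d ∧ not y) * 𝟙 a) + 𝟙 y * (𝟙 (c ∧ not x) * 𝟙 a)
      bool₂ false c d x y p = z≤n
      bool₂ true c d true true p = z≤n
      bool₂ true c d true false p with p refl
      ... | refl , refl , _ = ≤-refl
      bool₂ true c d false true p with p refl
      ... | refl , refl , _ = ≤-refl
      bool₂ true c d false false p = ⊥-elim (proj₂ (proj₂ (p refl)) refl refl)
      pw : ∀ u v → together matched u v + extra matched u v ≤ D u v + MM u v + (across u v + across′ u v)
      pw u v = +-mono-≤ (bool₁ (C u) (u == v) (matched u) (matched v) (diag matched))
        (subst (λ a → extra matched u v ≤ across u v + 𝟙 (matched v) * (𝟙 (unmatched u) * 𝟙 a)) (A-sym u v)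
          (bool₂ (A u v) (C u) (C v) (matched u) (matched v) (edge⇒some-matched u v)))

    -- Beyond the terms for the whole matched set there are diagonal pairs of bottoms and,
    -- generously, all pairs between bottoms and core.
    load-reducedCore : load reducedCore ≤ U + h + count reducedCore * count reducedCore + 2 * (h * count reducedCore) + 2 * (h * U + l * 2)
    load-reducedCore = begin
      load reducedCore
        ≤⟨ sum-mono (λ u → sum-mono (pw u)) ⟩
      ∑[ u < N ] ∑[ v < N ] (D u v + KK u v + (LK u v + LK v u) + (across u v + across′ u v))
        ≡⟨ sum₂-distrib-+ (λ u v → D u v + KK u v + (LK u v + LK v u)) (λ u v → across u v + across′ u v) ⟩
      ∑[ u < N ] ∑[ v < N ] (D u v + KK u v + (LK u v + LK v u)) + ∑[ u < N ] ∑[ v < N ] (across u v + across′ u v)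
        ≤⟨ +-mono-≤ (≤-reflexive (trans (sum₂-distrib-+ (λ u v → D u v + KK u v) (λ u v → LK u v + LK v u))
             (cong₂ _+_ (sum₂-distrib-+ D KK) (trans (sum₂-distrib-+ LK (λ u v → LK v u)) (cong (∑[ u < N ] ∑[ v < N ] LK u v +_) (∑-comm (λ u v → LK v u))))))) sum-both ⟩
      ∑[ u < N ] ∑[ v < N ] D u v + ∑[ u < N ] ∑[ v < N ] KK u v + (∑[ u < N ] ∑[ v < N ] LK u v + ∑[ u < N ] ∑[ v < N ] LK u v) + 2 * (h * U + l * 2)
        ≡⟨ cong (_+ 2 * (h * U + l * 2)) (cong₂ _+_ (cong₂ _+_
             (trans (sum-diagonal (λ u → 𝟙 (unmatched u) + 𝟙 (loose u))) (trans (∑-distrib-+ (𝟙 ∘ unmatched) (𝟙 ∘ loose)) (cong (U +_) Bottom.count-image)))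
             (sum-product (𝟙 ∘ reducedCore) (𝟙 ∘ reducedCore))) (trans (cong₂ _+_ sum-LK sum-LK) (cong (h * count reducedCore +_) (sym (+-identityʳ _))))) ⟩
      U + h + count reducedCore * count reducedCore + 2 * (h * count reducedCore) + 2 * (h * U + l * 2) ∎
      where
      open ≤-Reasoning
      D KK LK : Fin N → Fin N → ℕ
      D u v = δ u v * (𝟙 (unmatched u) + 𝟙 (loose u))
      KK u v = 𝟙 (reducedCore u) * 𝟙 (reducedCore v)
      LK u v = 𝟙 (loose u) * 𝟙 (reducedCore v)
      sum-LK : ∑[ u < N ] ∑[ v < N ] LK u v ≡ h * count reducedCore
      sum-LK = trans (sum-product (𝟙 ∘ loose) (𝟙 ∘ reducedCore)) (cong (_* count reducedCore) Bottom.count-image)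
      loose-independent : ∀ u v → A u v ≡ true → loose u ≡ true → loose v ≡ true → ⊥
      loose-independent u v e p q with Bottom.image? u | Bottom.image? v
      ... | yes (i , hi , refl) | yes (j , hj , refl) = case trans (sym e) (bottoms-independent i j hi hj) of λ ()
      bool₁ : ∀ c d x y x′ y′ → (x′ ≡ true → x ≡ true) → (d ≡ true → x ≡ y) → (d ≡ true → x′ ≡ y′) →
        𝟙 c * 𝟙 (d ∨ ((x ∧ not x′) ∧ (y ∧ not y′))) ≤ 𝟙 d * (𝟙 (c ∧ not x) + 𝟙 x′) + 𝟙 (x ∧ not x′) * 𝟙 (y ∧ not y′)
      bool₁ false d x y x′ y′ o p q = z≤n
      bool₁ true true x y x′ y′ o p q with p refl | q refl
      bool₁ true true true y true y′ o p q | refl | refl = s≤s z≤n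
      bool₁ true true true y false y′ o p q | refl | refl = s≤s z≤n
      bool₁ true true false y x′ y′ o p q | refl | refl = s≤s z≤n
      bool₁ true false x y x′ y′ o p q with x ∧ not x′ | y ∧ not y′
      ... | true | true = ≤-refl
      ... | true | false = z≤n
      ... | false | _ = z≤n
      bool₂ : ∀ a c d x y x′ y′ → (x′ ≡ true → x ≡ true) → (y′ ≡ true → y ≡ true) → (a ≡ true → x′ ≡ true → y′ ≡ true → ⊥) →
        (a ≡ true → c ≡ true × d ≡ true × (x ≡ false → y ≡ false → ⊥)) →
        𝟙 (a ∧ not ((x ∧ not x′) ∧ (y ∧ not y′))) ≤ (𝟙 x′ * 𝟙 (y ∧ not y′) + 𝟙 y′ * 𝟙 (x ∧ not x′)) +
          (𝟙 x * (𝟙 (d ∧ not y) * 𝟙 a) + 𝟙 y * (𝟙 (c ∧ not x) * 𝟙 a))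
      bool₂ false c d x y x′ y′ ox oy i p = z≤n
      bool₂ true c d x y x′ y′ ox oy i p with p refl
      bool₂ true c d true true true true ox oy i p | refl , refl , _ = ⊥-elim (i refl refl refl)
      bool₂ true c d true true true false ox oy i p | refl , refl , _ = s≤s z≤n
      bool₂ true c d true true false true ox oy i p | refl , refl , _ = s≤s z≤n
      bool₂ true c d true true false false ox oy i p | refl , refl , _ = z≤n
      bool₂ true c d true false x′ true ox oy i p | refl , refl , _ = case oy refl of λ ()
      bool₂ true c d true false true false ox oy i p | refl , refl , _ = s≤s z≤n
      bool₂ true c d true false false false ox oy i p | refl , refl , _ = s≤s z≤n
      bool₂ true c d false true true y′ ox oy i p | refl , refl , _ = case ox refl of λ ()
      bool₂ true c d false true false true ox oy i p | refl , refl , _ = s≤s z≤n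
      bool₂ true c d false true false false ox oy i p | refl , refl , _ = s≤s z≤n
      bool₂ true c d false false x′ y′ ox oy i p | refl , refl , n = ⊥-elim (n refl refl)
      assoc : ∀ a b c d e → a + b + (c + d + e) ≡ a + b + (c + d) + e
      assoc = solve-∀
      pw : ∀ u v → together reducedCore u v + extra reducedCore u v ≤ D u v + KK u v + (LK u v + LK v u) + (across u v + across′ u v)
      pw u v = ≤-trans (+-mono-≤
        (bool₁ (C u) (u == v) (matched u) (matched v) (loose u) (loose v) (loose⇒matched u) (diag matched) (diag loose))
        (subst (λ a → extra reducedCore u v ≤ LK u v + LK v u + (across u v + 𝟙 (matched v) * (𝟙 (unmatched u) * 𝟙 a))) (A-sym u v)
          (bool₂ (A u v) (C u) (C v) (matched u) (matched v) (loose u) (loose v) (loose⇒matched u) (loose⇒matched v)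
            (loose-independent u v) (edge⇒some-matched u v))))
        (≤-reflexive (assoc (D u v) (KK u v) (LK u v) (LK v u) _))

-- The loss of a class

≤-excess : ∀ {a b} → a ≤ b → ∃ λ c → b ≡ a + c
≤-excess p = map₂ sym (m≤n⇒∃[o]m+o≡n p)

-- What remains of 2mc for the core that leaves out the non-hub ends of the heavy edges; here
-- h and l count heavy and light matching edges, U unmatched vertices, and m = 1 + (h + l) + r.
reduced-loss : (h l r U : ℕ) → ℕ
reduced-loss h l r U = 2 * r * (2 * (h + l) + U) + 2 * l * U + U + h * h + 3 * h

-- The slack in the bound for the matched core contains (1 + 2l + 2r) * U, and with fewer than m/2
-- hubs this coefficient is at least m: every unmatched vertex costs m.
matched-bound : ∀ h l r U → 2 * h < 1 + (h + l) + r →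
  U + 2 * (h + l) * (2 * (h + l)) + 2 * (h * U + l * 2) + (1 + (h + l) + r) * U ≤ 2 * (1 + (h + l) + r) * (2 * (h + l) + U)
matched-bound h l r U p = begin
  U + 2 * (h + l) * (2 * (h + l)) + 2 * (h * U + l * 2) + (1 + (h + l) + r) * U
    ≤⟨ +-monoʳ-≤ (U + 2 * (h + l) * (2 * (h + l)) + 2 * (h * U + l * 2)) (*-monoˡ-≤ U m≤) ⟩
  U + 2 * (h + l) * (2 * (h + l)) + 2 * (h * U + l * 2) + (1 + 2 * l + 2 * r) * U
    ≤⟨ m≤m+n _ (2 * r * (2 * (h + l)) + 4 * h) ⟩
  U + 2 * (h + l) * (2 * (h + l)) + 2 * (h * U + l * 2) + (1 + 2 * l + 2 * r) * U + (2 * r * (2 * (h + l)) + 4 * h)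
    ≡⟨ ident h l r U ⟩
  2 * (1 + (h + l) + r) * (2 * (h + l) + U) ∎
  where
  open ≤-Reasoning
  ident : ∀ h l r U → U + 2 * (h + l) * (2 * (h + l)) + 2 * (h * U + l * 2) + (1 + 2 * l + 2 * r) * U + (2 * r * (2 * (h + l)) + 4 * h)
    ≡ 2 * (1 + (h + l) + r) * (2 * (h + l) + U)
  ident = solve-∀
  shift : ∀ h l r → 1 + (h + l) + r + (1 + (h + l) + r) ≡ 1 + 2 * l + 2 * r + suc (2 * h)
  shift = solve-∀
  m≤ : 1 + (h + l) + r ≤ 1 + 2 * l + 2 * r
  m≤ = +-cancelʳ-≤ (suc (2 * h)) _ _ (≤-trans (+-monoʳ-≤ (1 + (h + l) + r) p) (≤-reflexive (shift h l r)))

-- Since κ² + 2hκ = (κ + h)² - h², the core size enters only through κ + h, the number of matched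
-- vertices; the h² reappears in the loss.
reduced-bound : ∀ h l r U κ → κ + h ≡ 2 * (h + l) →
  U + h + κ * κ + 2 * (h * κ) + 2 * (h * U + l * 2) + reduced-loss h l r U ≡ 2 * (1 + (h + l) + r) * (2 * (h + l) + U)
reduced-bound h l r U κ p = trans (ident h l r U κ) (trans (cong (λ x → x * x + rest) p) (ident′ h l r U))
  where
  rest = 2 * U + 4 * h + 4 * l + 2 * h * U + 2 * l * U + 2 * r * (2 * (h + l) + U)
  ident : ∀ h l r U κ → U + h + κ * κ + 2 * (h * κ) + 2 * (h * U + l * 2) + (2 * r * (2 * (h + l) + U) + 2 * l * U + U + h * h + 3 * h)
    ≡ (κ + h) * (κ + h) + (2 * U + 4 * h + 4 * l + 2 * h * U + 2 * l * U + 2 * r * (2 * (h + l) + U))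
  ident = solve-∀
  ident′ : ∀ h l r U → 2 * (h + l) * (2 * (h + l)) + (2 * U + 4 * h + 4 * l + 2 * h * U + 2 * l * U + 2 * r * (2 * (h + l) + U))
    ≡ 2 * (1 + (h + l) + r) * (2 * (h + l) + U)
  ident′ = solve-∀

-- Here 1 + l + r is m - h. Size at least 3m means U ≥ 3 + h + l + 3r; after this substitution the
-- difference of the sides is a polynomial with nonnegative coefficients.
large-loss : ∀ h l r U → 3 * (1 + (h + l) + r) ≤ 2 * (h + l) + U →
  (1 + (h + l) + r) * (1 + (h + l) + r) + (1 + l + r) * (1 + l + r) ≤ reduced-loss h l r U
large-loss h l r U p with ≤-excess {3 + h + l + 3 * r} {U} (+-cancelˡ-≤ (2 * (h + l)) _ _ (≤-trans (≤-reflexive (shift h l r)) p))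
  where
  shift : ∀ h l r → 2 * (h + l) + (3 + h + l + 3 * r) ≡ 3 * (1 + (h + l) + r)
  shift = solve-∀
... | y , refl = ≤-trans (m≤m+n _ _) (≤-reflexive (ident h l r y))
  where
  ident : ∀ h l r y →
    (1 + (h + l) + r) * (1 + (h + l) + r) + (1 + l + r) * (1 + l + r) +
      (4 * r * h + 2 * h + 1 + 3 * l + 5 * r + 8 * l * r + 4 * r * r + 2 * r * y + 2 * l * y + y)
    ≡ 2 * r * (2 * (h + l) + (3 + h + l + 3 * r + y)) + 2 * l * (3 + h + l + 3 * r + y) + (3 + h + l + 3 * r + y) + h * h + 3 * h
  ident = solve-∀

-- A class of size 2m + u, u < m, with at least m/2 hubs. In terms of s = 2h - m one has h = 1 + l +
-- r + s and U = 2 + 2r + u, and the estimates compare polynomials in these parameters.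
module Medium h l r U u (m≤2h : 1 + (h + l) + r ≤ 2 * h)
  (size : 2 * (h + l) + U ≡ 2 * (1 + (h + l) + r) + u) (u<m : u < 1 + (h + l) + r) where
  open ≤-Reasoning

  private
    U≡ : U ≡ 2 + 2 * r + u
    U≡ = +-cancelˡ-≡ (2 * (h + l)) U (2 + 2 * r + u) (trans size (shift h l r u))
      where
      shift : ∀ h l r u → 2 * (1 + (h + l) + r) + u ≡ 2 * (h + l) + (2 + 2 * r + u)
      shift = solve-∀

    h≡ : ∃ λ s → h ≡ 1 + l + r + s
    h≡ = ≤-excess (+-cancelˡ-≤ h _ _ (≤-trans (≤-reflexive (shift h l r)) (≤-trans m≤2h (≤-reflexive (cong (h +_) (+-identityʳ h))))))
      where
      shift : ∀ h l r → h + (1 + l + r) ≡ 1 + (h + l) + r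
      shift = solve-∀

  medium-excess : (1 + (h + l) + r) * u ≤ reduced-loss h l r U
  medium-excess with U≡ | h≡
  ... | refl | s , refl = begin
    (1 + (1 + l + r + s + l) + r) * u
      ≡⟨ ident₁ l r s u ⟩
    u + 2 * l * u + r * u + (1 + r + s) * u
      ≤⟨ +-monoʳ-≤ (u + 2 * l * u + r * u) (*-monoʳ-≤ (1 + r + s) (≤-pred u<m)) ⟩
    u + 2 * l * u + r * u + (1 + r + s) * (1 + l + r + s + l + r)
      ≤⟨ m≤m+n _ _ ⟩
    u + 2 * l * u + r * u + (1 + r + s) * (1 + l + r + s + l + r) + (12 * l * r + 12 * r + 7 * r * r + 3 * r * s + r * u + 7 * l + 5 + l * l + 3 * s)
      ≡⟨ ident₂ l r s u ⟩
    reduced-loss (1 + l + r + s) l r (2 + 2 * r + u) ∎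
    where
    ident₁ : ∀ l r s u → (1 + (1 + l + r + s + l) + r) * u ≡ u + 2 * l * u + r * u + (1 + r + s) * u
    ident₁ = solve-∀
    ident₂ : ∀ l r s u → u + 2 * l * u + r * u + (1 + r + s) * (1 + l + r + s + l + r) + (12 * l * r + 12 * r + 7 * r * r + 3 * r * s + r * u + 7 * l + 5 + l * l + 3 * s)
      ≡ 2 * r * (2 * (1 + l + r + s + l) + (2 + 2 * r + u)) + 2 * l * (2 + 2 * r + u) + (2 + 2 * r + u) + (1 + l + r + s) * (1 + l + r + s) + 3 * (1 + l + r + s)
    ident₂ = solve-∀

  -- In the difference of the sides `U` has coefficient 2l + 2r - s. If s = 2l + y, the shortfall y
  -- * U is bounded through U ≤ 3 + 2l + 4r + s, a consequence of u < m, and then absorbed by the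
  -- square of h in the loss.
  medium-waste : (1 + (h + l) + r) * (U + h) ≤ 2 * reduced-loss h l r U
  medium-waste with h≡
  ... | s , refl with ≤-total s (2 * l)
  ...   | inj₁ s≤2l = +-cancelʳ-≤ (2 * l * U) _ _ (begin
    (1 + (1 + l + r + s + l) + r) * (U + (1 + l + r + s)) + 2 * l * U
      ≤⟨ m≤m+n _ _ ⟩
    (1 + (1 + l + r + s + l) + r) * (U + (1 + l + r + s)) + 2 * l * U + (16 * l * r + 14 * r + 8 * r * r + 9 * r * s + 2 * U * r + 6 * l + l * s + 6 + 7 * s + s * s)
      ≡⟨ ident l r s U ⟩
    2 * reduced-loss (1 + l + r + s) l r U + s * U
      ≤⟨ +-monoʳ-≤ (2 * reduced-loss (1 + l + r + s) l r U) (*-monoˡ-≤ U s≤2l) ⟩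
    2 * reduced-loss (1 + l + r + s) l r U + 2 * l * U ∎)
    where
    ident : ∀ l r s U → (1 + (1 + l + r + s + l) + r) * (U + (1 + l + r + s)) + 2 * l * U + (16 * l * r + 14 * r + 8 * r * r + 9 * r * s + 2 * U * r + 6 * l + l * s + 6 + 7 * s + s * s)
      ≡ 2 * (2 * r * (2 * (1 + l + r + s + l) + U) + 2 * l * U + U + (1 + l + r + s) * (1 + l + r + s) + 3 * (1 + l + r + s)) + s * U
    ident = solve-∀
  ...   | inj₂ 2l≤s with ≤-excess 2l≤s
  ...     | y , refl = +-cancelʳ-≤ (y * U) _ _ (begin
    (1 + (1 + l + r + (2 * l + y) + l) + r) * (U + (1 + l + r + (2 * l + y))) + y * U
      ≤⟨ +-monoʳ-≤ ((1 + (1 + l + r + (2 * l + y) + l) + r) * (U + (1 + l + r + (2 * l + y)))) (*-monoʳ-≤ y U≤) ⟩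
    (1 + (1 + l + r + (2 * l + y) + l) + r) * (U + (1 + l + r + (2 * l + y))) + y * (3 + 2 * l + 4 * r + (2 * l + y))
      ≤⟨ m≤m+n _ _ ⟩
    (1 + (1 + l + r + (2 * l + y) + l) + r) * (U + (1 + l + r + (2 * l + y))) + y * (3 + 2 * l + 4 * r + (2 * l + y))
      + (34 * l * r + 14 * r + 8 * r * r + 5 * r * y + 2 * U * r + 6 * l * l + 20 * l + l * y + 6 + 4 * y)
      ≡⟨ ident l r y U ⟩
    2 * reduced-loss (1 + l + r + (2 * l + y)) l r U + y * U ∎)
    where
    ident : ∀ l r y U → (1 + (1 + l + r + (2 * l + y) + l) + r) * (U + (1 + l + r + (2 * l + y))) + y * (3 + 2 * l + 4 * r + (2 * l + y))
      + (34 * l * r + 14 * r + 8 * r * r + 5 * r * y + 2 * U * r + 6 * l * l + 20 * l + l * y + 6 + 4 * y)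
      ≡ 2 * (2 * r * (2 * (1 + l + r + (2 * l + y) + l) + U) + 2 * l * U + U + (1 + l + r + (2 * l + y)) * (1 + l + r + (2 * l + y)) + 3 * (1 + l + r + (2 * l + y))) + y * U
    ident = solve-∀
    shift : ∀ l r y → 2 + 2 * r + (1 + l + r + (2 * l + y) + l + r) ≡ 3 + 2 * l + 4 * r + (2 * l + y)
    shift = solve-∀
    U≤ : U ≤ 3 + 2 * l + 4 * r + (2 * l + y)
    U≤ = ≤-trans (≤-reflexive U≡) (≤-trans (+-monoʳ-≤ (2 + 2 * r) (≤-pred u<m)) (≤-reflexive (shift l r y)))

  -- Compensates for the factor 2 in `medium-waste`: a class with such a surplus cannot occur in a
  -- colour whose total surplus is below m²/4.
  medium-quarter : (1 + (h + l) + r) * (1 + (h + l) + r) ≤ 4 * reduced-loss h l r U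
  medium-quarter = begin
    (1 + (h + l) + r) * (1 + (h + l) + r)  ≤⟨ *-mono-≤ m≤2h m≤2h ⟩
    2 * h * (2 * h)                        ≡⟨ ident h ⟩
    4 * (h * h)                            ≤⟨ *-monoʳ-≤ 4 (≤-trans (m≤n+m (h * h) (2 * r * (2 * (h + l) + U) + 2 * l * U + U)) (m≤m+n _ (3 * h))) ⟩
    4 * reduced-loss h l r U               ∎
    where
    ident : ∀ h → 2 * h * (2 * h) ≡ 4 * (h * h)
    ident = solve-∀

module Outcomes {N : ℕ} (C : Fin N → Bool) (A : Fin N → Fin N → Bool)
  (A-sym : ∀ u v → A u v ≡ A v u) (A-irrefl : ∀ u → A u u ≡ false)
  (A⊆C : ∀ u v → A u v ≡ true → C u ≡ true) (m : ℕ) where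

  open Class C A A-sym A-irrefl A⊆C
  open Matchings A A-sym

  -- The size is compared with the nearest of 0 and 2m (big = false, true) if it is at most 2m,
  -- and with 2m otherwise; the surplus is the loss not due to a deficit.
  record Small (core : Fin N → Bool) (loss : ℕ) : Set where
    field
      big          : Bool
      deficit excess waste surplus : ℕ
      size-eq      : count C + deficit ≡ 2 * m * 𝟙 big + excess
      deficit≤m    : deficit ≤ m
      loss-eq      : loss + deficit * deficit ≡ 2 * m * deficit + surplus
      m*excess≤    : m * excess ≤ surplus
      waste-eq     : count C ≡ count core + waste
      m*waste≤     : m * waste ≤ 2 * surplus
      waste-or     : m * waste ≤ surplus ⊎ m * m ≤ 4 * surplus
      core⇒big     : ∀ v → core v ≡ true → big ≡ true

  -- Of a large class only the hubs matter later: either they are many and meet the cores of another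
  -- colour, or `gap` is big and adds to the loss.
  record Large (core : Fin N → Bool) (loss : ℕ) : Set where
    field
      hub      : Fin N → Bool
      hub⊆core : ∀ v → hub v ≡ true → core v ≡ true
      gap      : ℕ
      hub+gap  : count hub + gap ≡ m
      loss≥    : m * m + gap * gap ≤ loss

  record Outcome : Set where
    field
      core    : Fin N → Bool
      core⊆C  : core ⊆C
      loss    : ℕ
      load≤   : load core + loss ≤ 2 * m * count C
      kind    : Small core loss ⊎ Large core loss

  -- With an empty core all c vertices are both excess and waste; the loss c(2m - c) is at least mc
  -- and pays for either. Labels carried by no vertex give empty classes, which land here with loss
  -- 0.
  tiny-outcome : count C ≤ m → Outcome
  tiny-outcome c≤m with ≤-excess {count C} {2 * m} (≤-trans c≤m (m≤m+n m _))
  ... | c′ , eq = record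
    { core = λ _ → false ; core⊆C = λ _ () ; loss = c * c′
    ; load≤ = ≤-trans (+-monoˡ-≤ (c * c′) (load≤square (λ _ → false) λ _ ()))
        (≤-reflexive (trans (sym (*-distribˡ-+ c c c′)) (trans (cong (c *_) (sym eq)) (*-comm c (2 * m)))))
    ; kind = inj₁ record
      { big = false ; deficit = 0 ; excess = c ; waste = c ; surplus = c * c′
      ; size-eq = trans (+-identityʳ c) (cong (_+ c) (sym (*-zeroʳ (2 * m))))
      ; deficit≤m = z≤n
      ; loss-eq = trans (+-identityʳ (c * c′)) (cong (_+ c * c′) (sym (*-zeroʳ (2 * m))))
      ; m*excess≤ = mc≤ ; waste-eq = cong (_+ c) (sym (sum-zero {N} λ _ → refl))
      ; m*waste≤ = ≤-trans mc≤ (m≤m+n _ _) ; waste-or = inj₁ mc≤ ; core⇒big = λ _ () } }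
    where
    c = count C
    m≤c′ : m ≤ c′
    m≤c′ = +-cancelˡ-≤ c m c′ (≤-trans (+-monoˡ-≤ m c≤m) (≤-reflexive (trans (cong (m +_) (sym (+-identityʳ m))) eq)))
    mc≤ : m * c ≤ c * c′
    mc≤ = ≤-trans (≤-reflexive (*-comm m c)) (*-monoʳ-≤ c m≤c′)

  -- The whole class is the core, so nothing is wasted, and the loss cd = 2md - d² is entirely due
  -- to the deficit d.
  clique-outcome : m < count C → count C ≤ 2 * m → Outcome
  clique-outcome m<c c≤2m with ≤-excess c≤2m
  ... | d , eq = record
    { core = C ; core⊆C = λ _ p → p ; loss = c * d
    ; load≤ = ≤-trans (+-monoˡ-≤ (c * d) (load≤square C λ _ p → p))
        (≤-reflexive (trans (sym (*-distribˡ-+ c c d)) (trans (cong (c *_) (sym eq)) (*-comm c (2 * m)))))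
    ; kind = inj₁ record
      { big = true ; deficit = d ; excess = 0 ; waste = 0 ; surplus = 0
      ; size-eq = trans (sym eq) (trans (sym (*-identityʳ (2 * m))) (sym (+-identityʳ (2 * m * 1))))
      ; deficit≤m = +-cancelˡ-≤ m d m (≤-trans (+-monoˡ-≤ d (<⇒≤ m<c)) (≤-reflexive (trans (sym eq) (cong (m +_) (+-identityʳ m)))))
      ; loss-eq = trans (sym (*-distribʳ-+ d c d)) (trans (cong (_* d) (sym eq)) (sym (+-identityʳ (2 * m * d))))
      ; m*excess≤ = ≤-reflexive (*-zeroʳ m) ; waste-eq = sym (+-identityʳ c)
      ; m*waste≤ = ≤-reflexive (*-zeroʳ m) ; waste-or = inj₁ (≤-reflexive (*-zeroʳ m)) ; core⇒big = λ _ _ → refl } }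
    where
    c = count C

  module _ (S : Stuck) {r : ℕ} (m≡ : m ≡ 1 + (h S + l S) + r) where

    private
      t≡ : Stuck.size S ≡ h S + l S
      t≡ = sym (h+l≡t S)
      c≡ : count C ≡ 2 * ((h S) + (l S)) + U S
      c≡ = trans (count-C S) (cong (λ t → 2 * t + U S) t≡)

    -- With few hubs all matched vertices can stay in the core: the loss m * U pays exactly for the
    -- waste U, and U is at least the excess because fewer than m edges are matched.
    matched-outcome : 2 * m ≤ count C → 2 * (h S) < m → Outcome
    matched-outcome 2m≤c 2h<m with ≤-excess 2m≤c
    ... | u , eq = record
      { core = matched S ; core⊆C = matched⊆C S ; loss = m * U S
      ; load≤ = ≤-trans (+-monoˡ-≤ (m * U S) (load-matched S)) bound
      ; kind = inj₁ record
        { big = true ; deficit = 0 ; excess = u ; waste = U S ; surplus = m * U S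
        ; size-eq = trans (+-identityʳ (count C)) (trans eq (cong (_+ u) (sym (*-identityʳ (2 * m)))))
        ; deficit≤m = z≤n
        ; loss-eq = trans (+-identityʳ (m * U S)) (cong (_+ m * U S) (sym (*-zeroʳ (2 * m))))
        ; m*excess≤ = *-monoʳ-≤ m u≤U
        ; waste-eq = trans (count-C S) (cong (_+ U S) (sym (count-matched S)))
        ; m*waste≤ = m≤m+n _ _ ; waste-or = inj₁ ≤-refl ; core⇒big = λ _ _ → refl } }
      where
      bound : U S + 2 * Stuck.size S * (2 * Stuck.size S) + 2 * (h S * U S + l S * 2) + m * U S ≤ 2 * m * count C
      bound = generic {h = h S} {l S} {r} {U S} t≡ m≡ c≡ 2h<m
        where
        generic : ∀ {t m c h l r U} → t ≡ h + l → m ≡ 1 + (h + l) + r → c ≡ 2 * (h + l) + U → 2 * h < m →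
          U + 2 * t * (2 * t) + 2 * (h * U + l * 2) + m * U ≤ 2 * m * c
        generic {h = h} {l} {r} {U} refl refl refl = matched-bound h l r U
      t≤m : (h S) + (l S) ≤ m
      t≤m = ≤-trans (≤-trans (n≤1+n _) (m≤m+n _ r)) (≤-reflexive (sym m≡))
      u≤U : u ≤ U S
      u≤U = +-cancelˡ-≤ (2 * ((h S) + (l S))) u (U S) (≤-trans (+-monoˡ-≤ u (*-monoʳ-≤ 2 t≤m)) (≤-reflexive (trans (sym eq) c≡)))

    reduced-outcome : Small (reducedCore S) (reduced-loss (h S) (l S) r (U S)) ⊎ Large (reducedCore S) (reduced-loss (h S) (l S) r (U S)) → Outcome
    reduced-outcome kind = record
      { core = reducedCore S ; core⊆C = reducedCore⊆C S ; loss = reduced-loss (h S) (l S) r (U S)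
      ; load≤ = ≤-trans (+-monoˡ-≤ _ (load-reducedCore S)) (≤-reflexive bound)
      ; kind = kind }
      where
      κ≡ : count (reducedCore S) + (h S) ≡ 2 * ((h S) + (l S))
      κ≡ = trans (count-reducedCore S) (cong (2 *_) t≡)
      bound : U S + h S + count (reducedCore S) * count (reducedCore S) + 2 * (h S * count (reducedCore S)) + 2 * (h S * U S + l S * 2) + reduced-loss (h S) (l S) r (U S) ≡ 2 * m * count C
      bound = trans (reduced-bound (h S) (l S) r (U S) (count (reducedCore S)) κ≡) (cong₂ (λ m c → 2 * m * c) (sym m≡) (sym c≡))

    medium-small : 2 * m ≤ count C → count C < 3 * m → m ≤ 2 * (h S) → Small (reducedCore S) (reduced-loss (h S) (l S) r (U S))
    medium-small 2m≤c c<3m m≤2h with ≤-excess 2m≤c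
    ... | u , eq = record
      { big = true ; deficit = 0 ; excess = u ; waste = U S + (h S) ; surplus = reduced-loss (h S) (l S) r (U S)
      ; size-eq = trans (+-identityʳ (count C)) (trans eq (cong (_+ u) (sym (*-identityʳ (2 * m)))))
      ; deficit≤m = z≤n
      ; loss-eq = trans (+-identityʳ _) (cong (_+ reduced-loss (h S) (l S) r (U S)) (sym (*-zeroʳ (2 * m))))
      ; m*excess≤ = subst (λ m → m * u ≤ R) (sym m≡) medium-excess
      ; waste-eq = waste-eq
      ; m*waste≤ = subst (λ m → m * (U S + (h S)) ≤ 2 * R) (sym m≡) medium-waste
      ; waste-or = inj₂ (subst (λ m → m * m ≤ 4 * R) (sym m≡) medium-quarter)
      ; core⇒big = λ _ _ → refl }
      where
      R = reduced-loss (h S) (l S) r (U S)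
      u<m : u < m
      u<m = +-cancelˡ-< (2 * m) u m (≤-trans (s≤s (≤-reflexive (sym eq))) (≤-trans c<3m (≤-reflexive (three m))))
        where
        three : ∀ m → 3 * m ≡ 2 * m + m
        three = solve-∀
      open Medium (h S) (l S) r (U S) u (≤-trans (≤-reflexive (sym m≡)) m≤2h)
        (trans (sym c≡) (trans eq (cong (λ m → 2 * m + u) m≡))) (≤-trans u<m (≤-reflexive m≡))
      waste-eq : count C ≡ count (reducedCore S) + (U S + (h S))
      waste-eq = trans (count-C S) (trans (cong (_+ U S) (sym (count-reducedCore S)))
        (trans (+-assoc (count (reducedCore S)) (h S) (U S)) (cong (count (reducedCore S) +_) (+-comm (h S) (U S)))))

    large-large : 3 * m ≤ count C → Large (reducedCore S) (reduced-loss (h S) (l S) r (U S))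
    large-large 3m≤c = record
      { hub = Top.image S ; hub⊆core = top⇒reducedCore S ; gap = 1 + (l S) + r
      ; hub+gap = trans (cong (_+ (1 + (l S) + r)) (Top.count-image S)) (trans (shift (h S) (l S) r) (sym m≡))
      ; loss≥ = subst (λ m → m * m + (1 + (l S) + r) * (1 + (l S) + r) ≤ reduced-loss (h S) (l S) r (U S)) (sym m≡)
          (large-loss (h S) (l S) r (U S) (≤-trans (≤-reflexive (cong (3 *_) (sym m≡))) (≤-trans 3m≤c (≤-reflexive c≡)))) }
      where
      shift : ∀ h l r → h + (1 + l + r) ≡ 1 + (h + l) + r
      shift = solve-∀

  outcome : (S : Stuck) → Stuck.size S < m → Outcome
  outcome S t<m with ≤-excess t<m
  ... | r , eq with trans eq (cong (λ t → 1 + t + r) (sym (h+l≡t S))) | count C ≤? m | count C ≤? 2 * m | 3 * m ≤? count C | m ≤? 2 * h S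
  ... | _ | yes p | _ | _ | _ = tiny-outcome p
  ... | m≡ | no p | yes q | _ | _ = clique-outcome (≰⇒> p) q
  ... | m≡ | no _ | no q | yes 3m≤c | _ = reduced-outcome S m≡ (inj₂ (large-large S m≡ 3m≤c))
  ... | m≡ | no _ | no q | no 3m≰c | yes m≤2h = reduced-outcome S m≡ (inj₁ (medium-small S m≡ (<⇒≤ (≰⇒> q)) (≰⇒> 3m≰c) m≤2h))
  ... | m≡ | no _ | no q | no _ | no m≰2h = matched-outcome S m≡ (<⇒≤ (≰⇒> q)) (≰⇒> m≰2h)

-- Colours without large classes

2ab≤a²+b² : ∀ a b → 2 * a * b ≤ a * a + b * b
2ab≤a²+b² a b with ≤-total a b
... | inj₁ a≤b with ≤-excess a≤b
...   | c , refl = ≤-trans (m≤m+n _ (c * c)) (≤-reflexive (ident a c))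
  where
  ident : ∀ a c → 2 * a * (a + c) + c * c ≡ a * a + (a + c) * (a + c)
  ident = solve-∀
2ab≤a²+b² a b | inj₂ b≤a with ≤-excess b≤a
...   | c , refl = ≤-trans (m≤m+n _ (c * c)) (≤-reflexive (ident b c))
  where
  ident : ∀ b c → 2 * (b + c) * b + c * c ≡ (b + c) * (b + c) + b * b
  ident = solve-∀

module _ {N n : ℕ} (lab : Fin N → Fin n) (w : Fin N → ℕ) where

  private
    x : Fin n → ℕ
    x ℓ = ∑[ v < N ] (δ (lab v) ℓ * w v)

  sum-by-label : ∑[ ℓ < n ] ∑[ v < N ] (δ (lab v) ℓ * w v) ≡ sum w
  sum-by-label = trans (∑-comm (λ ℓ v → δ (lab v) ℓ * w v)) (sum-cong-≗ λ v → sum-δ (lab v) (λ _ → w v))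

  δ-δ : ∀ (i j : Fin n) → ∑[ ℓ < n ] (δ i ℓ * δ j ℓ) ≡ δ i j
  δ-δ i j = trans (sum-δ i (δ j)) (δ-sym j i)

  sum-squares : ∑[ ℓ < n ] (x ℓ * x ℓ) ≡ ∑[ u < N ] ∑[ v < N ] (δ (lab u) (lab v) * (w u * w v))
  sum-squares = begin
    ∑[ ℓ < n ] (x ℓ * x ℓ)
      ≡⟨ sum-cong-≗ (λ ℓ → sym (sum-product (λ u → δ (lab u) ℓ * w u) (λ v → δ (lab v) ℓ * w v))) ⟩
    ∑[ ℓ < n ] ∑[ u < N ] ∑[ v < N ] (δ (lab u) ℓ * w u * (δ (lab v) ℓ * w v))
      ≡⟨ ∑-comm (λ ℓ u → ∑[ v < N ] (δ (lab u) ℓ * w u * (δ (lab v) ℓ * w v))) ⟩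
    ∑[ u < N ] ∑[ ℓ < n ] ∑[ v < N ] (δ (lab u) ℓ * w u * (δ (lab v) ℓ * w v))
      ≡⟨ sum-cong-≗ (λ u → ∑-comm (λ ℓ v → δ (lab u) ℓ * w u * (δ (lab v) ℓ * w v))) ⟩
    ∑[ u < N ] ∑[ v < N ] ∑[ ℓ < n ] (δ (lab u) ℓ * w u * (δ (lab v) ℓ * w v))
      ≡⟨ sum-cong-≗ (λ u → sum-cong-≗ λ v → trans (sum-cong-≗ λ ℓ → swap (δ (lab u) ℓ) (w u) (δ (lab v) ℓ) (w v))
           (trans (sym (*-distribʳ-sum (w u * w v) (λ ℓ → δ (lab u) ℓ * δ (lab v) ℓ))) (cong (_* (w u * w v)) (δ-δ (lab u) (lab v))))) ⟩
    ∑[ u < N ] ∑[ v < N ] (δ (lab u) (lab v) * (w u * w v)) ∎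
    where
    open ≡-Reasoning
    swap : ∀ a b c d → a * b * (c * d) ≡ a * c * (b * d)
    swap = solve-∀

  -- Cauchy–Schwarz over the big labels, in the linearised form (α x − β)² ≥ 0.
  cells : (big : Fin n → Bool) → (∀ v → big (lab v) ≡ false → w v ≡ 0) → ∀ α β →
    2 * α * β * sum w ≤ α * α * ∑[ u < N ] ∑[ v < N ] (δ (lab u) (lab v) * (w u * w v)) + β * β * count big
  cells big w-big α β = begin
    2 * α * β * sum w                                        ≡⟨ cong (2 * α * β *_) (sym sum-by-label) ⟩
    2 * α * β * sum x                                        ≡⟨ *-distribˡ-sum (2 * α * β) x ⟩
    ∑[ ℓ < n ] (2 * α * β * x ℓ)                             ≤⟨ sum-mono pw ⟩
    ∑[ ℓ < n ] (α * α * (x ℓ * x ℓ) + β * β * 𝟙 (big ℓ))     ≡⟨ ∑-distrib-+ (λ ℓ → α * α * (x ℓ * x ℓ)) (λ ℓ → β * β * 𝟙 (big ℓ)) ⟩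
    ∑[ ℓ < n ] (α * α * (x ℓ * x ℓ)) + ∑[ ℓ < n ] (β * β * 𝟙 (big ℓ))
      ≡⟨ cong₂ _+_ (*-distribˡ-sum (α * α) (λ ℓ → x ℓ * x ℓ)) (*-distribˡ-sum (β * β) (𝟙 ∘ big)) ⟨
    α * α * ∑[ ℓ < n ] (x ℓ * x ℓ) + β * β * count big       ≡⟨ cong (λ y → α * α * y + β * β * count big) sum-squares ⟩
    α * α * ∑[ u < N ] ∑[ v < N ] (δ (lab u) (lab v) * (w u * w v)) + β * β * count big ∎
    where
    open ≤-Reasoning
    ident₁ : ∀ α β y → 2 * α * β * y ≡ 2 * (α * y) * β
    ident₁ = solve-∀
    ident₂ : ∀ α β y → α * y * (α * y) + β * β ≡ α * α * (y * y) + β * β * 1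
    ident₂ = solve-∀
    pw : ∀ ℓ → 2 * α * β * x ℓ ≤ α * α * (x ℓ * x ℓ) + β * β * 𝟙 (big ℓ)
    pw ℓ with big ℓ in eq
    ... | true = ≤-trans (≤-reflexive (ident₁ α β (x ℓ))) (≤-trans (2ab≤a²+b² (α * x ℓ) β) (≤-reflexive (ident₂ α β (x ℓ))))
    ... | false = ≤-trans (≤-reflexive (trans (cong (2 * α * β *_) x≡0) (*-zeroʳ (2 * α * β)))) z≤n
      where
      z : ∀ v → δ (lab v) ℓ * w v ≡ 0
      z v with lab v F.≟ ℓ
      ... | yes refl = trans (+-identityʳ (w v)) (w-big v eq)
      ... | no _ = refl
      x≡0 : x ℓ ≡ 0
      x≡0 = sum-zero z

-- The arithmetic of one colour without large classes. For each class, `c`, `d`, `a`, `w`, `e` are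
-- size, deficit, excess, waste and surplus.
module Family {n : ℕ} (m k f N : ℕ) (N+f : N + f ≡ 2 * k * m) (2f≤m : 2 * f ≤ m)
  (c d a w e loss : Fin n → ℕ) (big : Fin n → Bool)
  (Σc≡N : sum c ≡ N)
  (size-eq : ∀ ℓ → c ℓ + d ℓ ≡ 2 * m * 𝟙 (big ℓ) + a ℓ)
  (d≤m : ∀ ℓ → d ℓ ≤ m)
  (loss-eq : ∀ ℓ → loss ℓ + d ℓ * d ℓ ≡ 2 * m * d ℓ + e ℓ)
  (ma≤e : ∀ ℓ → m * a ℓ ≤ e ℓ)
  (mw≤2e : ∀ ℓ → m * w ℓ ≤ 2 * e ℓ)
  (mw≤e⊎ : ∀ ℓ → m * w ℓ ≤ e ℓ ⊎ m * m ≤ 4 * e ℓ) where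
  open ≤-Reasoning

  p L E D W : ℕ
  p = count big
  L = sum loss
  E = sum e
  D = sum d
  W = sum w

  private
    q : Fin n → ℕ
    q ℓ = d ℓ * (2 * m ∸ d ℓ)

    d≤2m : ∀ ℓ → d ℓ ≤ 2 * m
    d≤2m ℓ = ≤-trans (d≤m ℓ) (m≤m+n m _)

    loss≡ : ∀ ℓ → loss ℓ ≡ q ℓ + e ℓ
    loss≡ ℓ = +-cancelʳ-≡ (d ℓ * d ℓ) _ _ (begin-equality
      loss ℓ + d ℓ * d ℓ                              ≡⟨ loss-eq ℓ ⟩
      2 * m * d ℓ + e ℓ                               ≡⟨ cong (λ x → x * d ℓ + e ℓ) (m∸n+n≡m (d≤2m ℓ)) ⟨
      (2 * m ∸ d ℓ + d ℓ) * d ℓ + e ℓ                 ≡⟨ ident (d ℓ) (2 * m ∸ d ℓ) (e ℓ) ⟩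
      q ℓ + e ℓ + d ℓ * d ℓ                           ∎)
      where
      ident : ∀ d x e → (x + d) * d + e ≡ d * x + e + d * d
      ident = solve-∀

    L≡ : L ≡ sum q + E
    L≡ = trans (sum-cong-≗ loss≡) (∑-distrib-+ q e)

    total : N + D ≡ 2 * m * p + sum a
    total = begin-equality
      N + D                                          ≡⟨ cong (_+ D) Σc≡N ⟨
      sum c + D                                      ≡⟨ ∑-distrib-+ c d ⟨
      ∑[ ℓ < n ] (c ℓ + d ℓ)                         ≡⟨ sum-cong-≗ size-eq ⟩
      ∑[ ℓ < n ] (2 * m * 𝟙 (big ℓ) + a ℓ)           ≡⟨ ∑-distrib-+ (λ ℓ → 2 * m * 𝟙 (big ℓ)) a ⟩
      ∑[ ℓ < n ] (2 * m * 𝟙 (big ℓ)) + sum a         ≡⟨ cong (_+ sum a) (*-distribˡ-sum (2 * m) (𝟙 ∘ big)) ⟨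
      2 * m * p + sum a                              ∎

    m≤2m∸d : ∀ ℓ → m ≤ 2 * m ∸ d ℓ
    m≤2m∸d ℓ = ≤-trans (≤-reflexive (sym (trans (cong (λ x → m + x ∸ m) (+-identityʳ m)) (m+n∸m≡n m m)))) (∸-monoʳ-≤ (2 * m) (d≤m ℓ))

  E≤L : E ≤ L
  E≤L = ≤-trans (m≤n+m E (sum q)) (≤-reflexive (sym L≡))

  mW≤2E : m * W ≤ 2 * E
  mW≤2E = begin
    m * W                    ≡⟨ *-distribˡ-sum m w ⟩
    ∑[ ℓ < n ] (m * w ℓ)     ≤⟨ sum-mono mw≤2e ⟩
    ∑[ ℓ < n ] (2 * e ℓ)     ≡⟨ *-distribˡ-sum 2 e ⟨
    2 * E                    ∎

  -- A class satisfying only the second alternative of `mw≤e⊎` would on its own have more surplus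
  -- than the whole colour.
  mW≤E : 4 * E < m * m → m * W ≤ E
  mW≤E 4E<mm = begin
    m * W                    ≡⟨ *-distribˡ-sum m w ⟩
    ∑[ ℓ < n ] (m * w ℓ)     ≤⟨ sum-mono pw ⟩
    E                        ∎
    where
    pw : ∀ ℓ → m * w ℓ ≤ e ℓ
    pw ℓ with mw≤e⊎ ℓ
    ... | inj₁ le = le
    ... | inj₂ mm≤4e = ⊥-elim (<⇒≱ 4E<mm (≤-trans mm≤4e (*-monoʳ-≤ 4 (term≤sum e ℓ))))

  mD≤L : m * D ≤ L
  mD≤L = begin
    m * D                    ≡⟨ *-distribˡ-sum m d ⟩
    ∑[ ℓ < n ] (m * d ℓ)     ≤⟨ sum-mono (λ ℓ → ≤-trans (≤-reflexive (*-comm m (d ℓ))) (*-monoʳ-≤ (d ℓ) (m≤2m∸d ℓ))) ⟩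
    sum q                    ≤⟨ m≤m+n (sum q) E ⟩
    sum q + E                ≡⟨ L≡ ⟨
    L                        ∎

  -- With k + 1 big classes the deficits sum to at least 2(k + 1)m - N ≥ 2m, and each unit of
  -- deficit costs at least m.
  p≤k : L < 2 * (m * m) → p ≤ k
  p≤k L<2mm with p ≤? k
  ... | yes p≤k = p≤k
  ... | no p≰k = ⊥-elim (<⇒≱ L<2mm (+-cancelˡ-≤ (2 * k * m * m) (2 * (m * m)) L (begin
    2 * k * m * m + 2 * (m * m)        ≡⟨ ident k m ⟩
    m * (2 * m * suc k)                ≤⟨ *-monoʳ-≤ m (*-monoʳ-≤ (2 * m) (≰⇒> p≰k)) ⟩
    m * (2 * m * p)                    ≤⟨ *-monoʳ-≤ m (≤-trans (m≤m+n _ (sum a)) (≤-reflexive (sym total))) ⟩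
    m * (N + D)                        ≡⟨ *-distribˡ-+ m N D ⟩
    m * N + m * D                      ≤⟨ +-mono-≤ (*-monoʳ-≤ m (≤-trans (m≤m+n N f) (≤-reflexive N+f))) mD≤L ⟩
    m * (2 * k * m) + L                ≡⟨ cong (_+ L) (*-comm m (2 * k * m)) ⟩
    2 * k * m * m + L                  ∎)))
    where
    ident : ∀ k m → 2 * k * m * m + 2 * (m * m) ≡ m * (2 * m * suc k)
    ident = solve-∀

  private
    f≤m : f ≤ m
    f≤m = ≤-trans (m≤m+n f _) 2f≤m

    -- The function x(2m - x) increases up to m, so one deficit of at least f suffices. If all
    -- deficits are below f, each unit of deficit costs at least 2m - f.
    q-bound : f ≤ D → 2 * m * f ≤ sum q + f * f
    q-bound f≤D with F.any? (λ ℓ → f ≤? d ℓ)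
    ... | yes (ℓ , f≤d) = ≤-trans (aux (d ℓ) f≤d (d≤m ℓ)) (+-monoˡ-≤ (f * f) (term≤sum q ℓ))
      where
      aux : ∀ d → f ≤ d → d ≤ m → 2 * m * f ≤ d * (2 * m ∸ d) + f * f
      aux d f≤d d≤m with ≤-excess f≤d | ≤-excess d≤m
      ... | y , refl | z , eq = ≤-trans (m≤m+n _ (y * y + 2 * y * z)) (≤-reflexive (trans (cong (λ m → 2 * m * f + (y * y + 2 * y * z)) eq) (trans (ident f y z) (cong (λ x → (f + y) * x + f * f) (sym 2m∸d)))))
        where
        2m∸d : 2 * m ∸ (f + y) ≡ f + y + 2 * z
        2m∸d = trans (cong (λ m → 2 * m ∸ (f + y)) eq) (trans (cong (_∸ (f + y)) (shift f y z)) (m+n∸m≡n (f + y) (f + y + 2 * z)))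
          where
          shift : ∀ f y z → 2 * (f + y + z) ≡ f + y + (f + y + 2 * z)
          shift = solve-∀
        ident : ∀ f y z → 2 * (f + y + z) * f + (y * y + 2 * y * z) ≡ (f + y) * (f + y + 2 * z) + f * f
        ident = solve-∀
    ... | no ¬p with ≤-excess {f} {2 * m} (≤-trans f≤m (m≤m+n m _))
    ...   | x , eq = begin
      2 * m * f                          ≡⟨ cong (_* f) eq ⟩
      (f + x) * f                        ≡⟨ ident f x ⟩
      x * f + f * f                      ≤⟨ +-monoˡ-≤ (f * f) (*-monoʳ-≤ x f≤D) ⟩
      x * D + f * f                      ≡⟨ cong (_+ f * f) (*-distribˡ-sum x d) ⟩
      ∑[ ℓ < n ] (x * d ℓ) + f * f       ≤⟨ +-monoˡ-≤ (f * f) (sum-mono pw) ⟩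
      sum q + f * f                      ∎
      where
      ident : ∀ f x → (f + x) * f ≡ x * f + f * f
      ident = solve-∀
      pw : ∀ ℓ → x * d ℓ ≤ q ℓ
      pw ℓ = ≤-trans (≤-reflexive (*-comm x (d ℓ))) (*-monoʳ-≤ (d ℓ) (≤-trans (≤-reflexive (sym (trans (cong (_∸ f) eq) (m+n∸m≡n f x))))
        (∸-monoʳ-≤ (2 * m) (<⇒≤ (≰⇒> λ f≤d → ¬p (ℓ , f≤d))))))

  -- If at least k classes are big, the deficits sum to at least f, since N + f = 2km; if fewer,
  -- the excesses sum to at least 2m − f.
  loss-bound : E + 2 * m * f ≤ L + f * f ⊎ 3 * (m * m) ≤ 2 * L
  loss-bound with k ≤? p
  ... | yes k≤p = inj₁ (begin
    E + 2 * m * f                ≤⟨ +-monoʳ-≤ E (q-bound f≤D) ⟩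
    E + (sum q + f * f)          ≡⟨ trans (sym (+-assoc E (sum q) (f * f))) (cong (_+ f * f) (trans (+-comm E (sum q)) (sym L≡))) ⟩
    L + f * f                    ∎)
    where
    f≤D : f ≤ D
    f≤D = +-cancelˡ-≤ N f D (begin
      N + f              ≡⟨ N+f ⟩
      2 * k * m          ≤⟨ *-monoˡ-≤ m (*-monoʳ-≤ 2 k≤p) ⟩
      2 * p * m          ≡⟨ swap p m ⟩
      2 * m * p          ≤⟨ m≤m+n _ (sum a) ⟩
      2 * m * p + sum a  ≡⟨ total ⟨
      N + D              ∎)
      where
      swap : ∀ p m → 2 * p * m ≡ 2 * m * p
      swap = solve-∀
  ... | no k≰p = inj₂ (begin
    3 * (m * m)              ≡⟨ ident₁ m ⟩
    m * (3 * m)              ≤⟨ *-monoʳ-≤ m 3m≤2a ⟩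
    m * (2 * sum a)          ≡⟨ ident₂ m (sum a) ⟩
    2 * (m * sum a)          ≡⟨ cong (2 *_) (*-distribˡ-sum m a) ⟩
    2 * ∑[ ℓ < n ] (m * a ℓ) ≤⟨ *-monoʳ-≤ 2 (≤-trans (sum-mono ma≤e) E≤L) ⟩
    2 * L                    ∎)
    where
    ident₁ : ∀ m → 3 * (m * m) ≡ m * (3 * m)
    ident₁ = solve-∀
    ident₂ : ∀ m a → m * (2 * a) ≡ 2 * (m * a)
    ident₂ = solve-∀
    2m≤ : 2 * m ≤ sum a + f
    2m≤ = +-cancelˡ-≤ (N + 2 * m * p) _ _ (begin
      N + 2 * m * p + 2 * m           ≡⟨ shift₁ N m p ⟩
      N + 2 * suc p * m               ≤⟨ +-monoʳ-≤ N (*-monoˡ-≤ m (*-monoʳ-≤ 2 (≰⇒> k≰p))) ⟩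
      N + 2 * k * m                   ≡⟨ cong (N +_) N+f ⟨
      N + (N + f)                     ≤⟨ +-monoʳ-≤ N (+-monoˡ-≤ f (≤-trans (m≤m+n N D) (≤-reflexive total))) ⟩
      N + (2 * m * p + sum a + f)     ≡⟨ shift₂ N (2 * m * p) (sum a) f ⟩
      N + 2 * m * p + (sum a + f)     ∎)
      where
      shift₁ : ∀ N m p → N + 2 * m * p + 2 * m ≡ N + 2 * suc p * m
      shift₁ = solve-∀
      shift₂ : ∀ N x y f → N + (x + y + f) ≡ N + x + (y + f)
      shift₂ = solve-∀
    3m≤2a : 3 * m ≤ 2 * sum a
    3m≤2a = +-cancelʳ-≤ m _ _ (begin
      3 * m + m            ≡⟨ four m ⟩
      2 * (2 * m)          ≤⟨ *-monoʳ-≤ 2 2m≤ ⟩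
      2 * (sum a + f)      ≡⟨ *-distribˡ-+ 2 (sum a) f ⟩
      2 * sum a + 2 * f    ≤⟨ +-monoʳ-≤ (2 * sum a) 2f≤m ⟩
      2 * sum a + m        ∎)
      where
      four : ∀ m → 3 * m + m ≡ 2 * (2 * m)
      four = solve-∀

-- Counting pairs over all colours

==-true : ∀ {n} {u v : Fin n} → (u == v) ≡ true → u ≡ v
==-true {u = u} {v} p with u F.≟ v
... | yes q = q

==-refl : ∀ {n} (u : Fin n) → (u == u) ≡ true
==-refl u = dec-true (u F.≟ u) refl

module Colours {N k : ℕ} (G : ColouredGraph N k) (m : ℕ) where

  cls : Fin k → Fin N → Fin N
  cls = component G

  C : Fin k → Fin N → Fin N → Bool
  C i ℓ v = cls i v == ℓ

  has : Fin k → Fin N → Fin N → Bool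
  has i u v = does (Maybe.≡-dec F._≟_ (col G u v) (just i))

  has⇒col : ∀ {i u v} → has i u v ≡ true → col G u v ≡ just i
  has⇒col {i} {u} {v} p with Maybe.≡-dec F._≟_ (col G u v) (just i)
  ... | yes q = q

  has-cls : ∀ {i u v} → has i u v ≡ true → cls i u ≡ cls i v
  has-cls {i} p = component-edge G i (has⇒col p)

  A : Fin k → Fin N → Fin N → Fin N → Bool
  A i ℓ u v = C i ℓ u ∧ has i u v

  A-sym : ∀ i ℓ u v → A i ℓ u v ≡ A i ℓ v u
  A-sym i ℓ u v = trans (cong (C i ℓ u ∧_) has-sym) (aux (has i v u) refl)
    where
    has-sym : has i u v ≡ has i v u
    has-sym = cong (λ c → does (Maybe.≡-dec F._≟_ c (just i))) (symmetric G u v)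
    aux : ∀ b → has i v u ≡ b → C i ℓ u ∧ b ≡ C i ℓ v ∧ b
    aux true p = cong (λ x → (x == ℓ) ∧ true) (sym (has-cls p))
    aux false p = trans (B.∧-zeroʳ (C i ℓ u)) (sym (B.∧-zeroʳ (C i ℓ v)))

  A-irrefl : ∀ i ℓ u → A i ℓ u u ≡ false
  A-irrefl i ℓ u = trans (cong (λ c → C i ℓ u ∧ does (Maybe.≡-dec F._≟_ c (just i))) (loopless G u)) (B.∧-zeroʳ (C i ℓ u))

  A⊆C : ∀ i ℓ u v → A i ℓ u v ≡ true → C i ℓ u ≡ true
  A⊆C i ℓ u v = B.∧-conicalˡ (C i ℓ u) (has i u v)

  module Cls i ℓ = Class (C i ℓ) (A i ℓ) (A-sym i ℓ) (A-irrefl i ℓ) (A⊆C i ℓ)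
  module Out i ℓ = Outcomes (C i ℓ) (A i ℓ) (A-sym i ℓ) (A-irrefl i ℓ) (A⊆C i ℓ) m

  class-outcome : ∀ i ℓ → MonoConnMatching G m ⊎ Out.Outcome i ℓ
  class-outcome i ℓ with Matchings.matching-or-stuck (A i ℓ) (A-sym i ℓ) m
  ... | inj₂ (S , t<m) = inj₂ (Out.outcome i ℓ S t<m)
  ... | inj₁ M = inj₁ record
    { colour = i
    ; edge = e
    ; coloured = λ j → has⇒col (B.∧-conicalʳ (C i ℓ (end M j true)) _ (edge M j))
    ; disjoint = λ j j′ b b′ q → inj M j b j′ b′ (trans (sym (endpoint≡ j b)) (trans q (endpoint≡ j′ b′)))
    ; connected = λ j j′ → component-conn G i _ _ (trans (in-class j) (sym (in-class j′))) }
    where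
    open Matchings (A i ℓ) (A-sym i ℓ)
    e : Fin m → Fin N × Fin N
    e j = end M j true , end M j false
    endpoint≡ : ∀ j b → endpoint e j b ≡ end M j b
    endpoint≡ j true = refl
    endpoint≡ j false = refl
    in-class : ∀ j → cls i (end M j true) ≡ ℓ
    in-class j = ==-true (A⊆C i ℓ _ _ (edge M j))

  module Loads (out : ∀ i ℓ → Out.Outcome i ℓ) where

    core : Fin k → Fin N → Bool
    core i v = Out.Outcome.core (out i (cls i v)) v

    same : Fin k → Fin N → Fin N → Bool
    same i u v = (cls i u == cls i v) ∧ (core i u ∧ core i v)

    -- These are `together` and `extra` for whichever class contains `u`. The diagonal is covered by
    -- every colour, in agreement with the squares of cell sizes in `cells`, which include it.
    Q R : Fin k → Fin N → Fin N → ℕ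
    Q i u v = 𝟙 ((u == v) ∨ same i u v)
    R i u v = 𝟙 (has i u v ∧ not (core i u ∧ core i v))

    loss : Fin k → ℕ
    loss i = ∑[ ℓ < N ] Out.Outcome.loss (out i ℓ)

    sum-sizes : ∀ i → ∑[ ℓ < N ] count (C i ℓ) ≡ N
    sum-sizes i = trans (sum-cong-≗ λ ℓ → sum-cong-≗ λ v → sym (*-identityʳ (𝟙 (C i ℓ v))))
      (trans (sum-by-label (cls i) (λ _ → 1)) (trans (sum-const N 1) (*-identityʳ N)))

    load-by-class : ∀ i → ∑[ u < N ] ∑[ v < N ] (Q i u v + R i u v) ≤ ∑[ ℓ < N ] Cls.load i ℓ (Out.Outcome.core (out i ℓ))
    load-by-class i = begin
      ∑[ u < N ] ∑[ v < N ] (Q i u v + R i u v)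
        ≡⟨ sum-by-label (cls i) (λ u → ∑[ v < N ] (Q i u v + R i u v)) ⟨
      ∑[ ℓ < N ] ∑[ u < N ] (δ (cls i u) ℓ * ∑[ v < N ] (Q i u v + R i u v))
        ≤⟨ sum-mono (λ ℓ → sum-mono λ u → ≤-trans (≤-reflexive (*-distribˡ-sum (δ (cls i u) ℓ) (λ v → Q i u v + R i u v))) (sum-mono (pw ℓ u))) ⟩
      ∑[ ℓ < N ] Cls.load i ℓ (Out.Outcome.core (out i ℓ)) ∎
      where
      open ≤-Reasoning
      bool₁ : ∀ d s x y z → (s ≡ true → y ≡ z) → 𝟙 (d ∨ (s ∧ (x ∧ y))) ≤ 1 * 𝟙 (d ∨ (x ∧ z))
      bool₁ true s x y z p = ≤-refl
      bool₁ false false x y z p = z≤n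
      bool₁ false true true y z p with p refl
      ... | refl = ≤-reflexive (sym (+-identityʳ (𝟙 y)))
      bool₁ false true false y z p = z≤n
      bool₂ : ∀ a x y z → (a ≡ true → y ≡ z) → 𝟙 (a ∧ not (x ∧ y)) ≤ 𝟙 ((true ∧ a) ∧ not (x ∧ z))
      bool₂ false x y z p = z≤n
      bool₂ true x y z p with p refl
      ... | refl = ≤-refl
      pw : ∀ ℓ u v → δ (cls i u) ℓ * (Q i u v + R i u v) ≤ Cls.together i ℓ (Out.Outcome.core (out i ℓ)) u v + Cls.extra i ℓ (Out.Outcome.core (out i ℓ)) u v
      pw ℓ u v with cls i u F.≟ ℓ
      ... | no _ = z≤n
      ... | yes refl = ≤-trans (≤-reflexive (+-identityʳ (Q i u v + R i u v))) (+-mono-≤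
              (bool₁ (u == v) (cls i u == cls i v) (core i u) (core i v) (Out.Outcome.core (out i (cls i u)) v)
                (λ p → cong (λ ℓ → Out.Outcome.core (out i ℓ) v) (sym (==-true p))))
              (bool₂ (has i u v) (core i u) (core i v) (Out.Outcome.core (out i (cls i u)) v)
                (λ p → cong (λ ℓ → Out.Outcome.core (out i ℓ) v) (sym (has-cls p)))))

    load+loss : ∀ i → ∑[ u < N ] ∑[ v < N ] (Q i u v + R i u v) + loss i ≤ 2 * m * N
    load+loss i = begin
      ∑[ u < N ] ∑[ v < N ] (Q i u v + R i u v) + loss i
        ≤⟨ +-monoˡ-≤ (loss i) (load-by-class i) ⟩
      ∑[ ℓ < N ] Cls.load i ℓ (Out.Outcome.core (out i ℓ)) + loss i
        ≡⟨ ∑-distrib-+ (λ ℓ → Cls.load i ℓ (Out.Outcome.core (out i ℓ))) (λ ℓ → Out.Outcome.loss (out i ℓ)) ⟨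
      ∑[ ℓ < N ] (Cls.load i ℓ (Out.Outcome.core (out i ℓ)) + Out.Outcome.loss (out i ℓ))
        ≤⟨ sum-mono (λ ℓ → Out.Outcome.load≤ (out i ℓ)) ⟩
      ∑[ ℓ < N ] (2 * m * count (C i ℓ))
        ≡⟨ *-distribˡ-sum (2 * m) (λ ℓ → count (C i ℓ)) ⟨
      2 * m * ∑[ ℓ < N ] count (C i ℓ)
        ≡⟨ cong (2 * m *_) (sum-sizes i) ⟩
      2 * m * N ∎
      where open ≤-Reasoning

    missing : ℕ
    missing = ∑[ u < N ] ∑[ v < N ] 𝟙 (not (u == v) ∧ is-nothing (col G u v))

    shared : Fin k → Fin k → ℕ
    shared b i = ∑[ u < N ] ∑[ v < N ] (Q i u v * Q b u v)

    gain : Fin k → Fin k → ℕ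
    gain b i = loss i + 𝟙 (not (b == i)) * shared b i

    -- If `b` covers the pair by a core or as a loop, every other `Q i u v` is a repetition.
    -- Otherwise the products vanish, and it suffices that a pair of distinct vertices is a non-edge
    -- or is charged to its own colour.
    cover : ∀ b u v → 1 + ∑[ i < k ] (𝟙 (not (b == i)) * (Q i u v * Q b u v)) ≤ 𝟙 (not (u == v) ∧ is-nothing (col G u v)) + ∑[ i < k ] (Q i u v + R i u v)
    cover b u v = by-cases ((u == v) ∨ same b u v) refl
      where
      open ≤-Reasoning
      rhs = ∑[ i < k ] (Q i u v + R i u v)
      some-colour : ∀ (c : Maybe (Fin k)) d → col G u v ≡ c → (u == v) ≡ d → d ≡ false → 1 ≤ 𝟙 (not d ∧ is-nothing c) + rhs
      some-colour nothing .false e q refl = s≤s z≤n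
      some-colour (just i) .false e q refl = ≤-trans one (term≤sum (λ i → Q i u v + R i u v) i)
        where
        h : has i u v ≡ true
        h = dec-true (Maybe.≡-dec F._≟_ (col G u v) (just i)) e
        cl : (cls i u == cls i v) ≡ true
        cl = dec-true (cls i u F.≟ cls i v) (has-cls h)
        bool : ∀ d x → 1 ≤ 𝟙 (d ∨ (true ∧ x)) + 𝟙 (true ∧ not x)
        bool true x = s≤s z≤n
        bool false true = ≤-refl
        bool false false = ≤-refl
        one : 1 ≤ Q i u v + R i u v
        one = subst₂ (λ x y → 1 ≤ 𝟙 ((u == v) ∨ (x ∧ (core i u ∧ core i v))) + 𝟙 (y ∧ not (core i u ∧ core i v))) (sym cl) (sym h)
          (bool (u == v) (core i u ∧ core i v))
      by-cases : ∀ x → ((u == v) ∨ same b u v) ≡ x →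
        1 + ∑[ i < k ] (𝟙 (not (b == i)) * (Q i u v * 𝟙 x)) ≤ 𝟙 (not (u == v) ∧ is-nothing (col G u v)) + rhs
      by-cases true p = ≤-trans (begin
        1 + ∑[ i < k ] (𝟙 (not (b == i)) * (Q i u v * 1))
          ≡⟨ cong (_+ ∑[ i < k ] (𝟙 (not (b == i)) * (Q i u v * 1))) (sum-δ b (λ _ → 1)) ⟨
        ∑[ i < k ] (δ b i * 1) + ∑[ i < k ] (𝟙 (not (b == i)) * (Q i u v * 1))
          ≡⟨ ∑-distrib-+ (λ i → δ b i * 1) (λ i → 𝟙 (not (b == i)) * (Q i u v * 1)) ⟨
        ∑[ i < k ] (δ b i * 1 + 𝟙 (not (b == i)) * (Q i u v * 1))
          ≤⟨ sum-mono pw ⟩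
        rhs ∎) (m≤n+m rhs _)
        where
        pw : ∀ i → δ b i * 1 + 𝟙 (not (b == i)) * (Q i u v * 1) ≤ Q i u v + R i u v
        pw i with b F.≟ i
        ... | yes refl = ≤-trans (≤-reflexive (cong 𝟙 (sym p))) (m≤m+n (Q i u v) (R i u v))
        ... | no _ = ≤-trans (≤-reflexive (trans (+-identityʳ _) (*-identityʳ (Q i u v)))) (m≤m+n (Q i u v) (R i u v))
      by-cases false p = begin
        1 + ∑[ i < k ] (𝟙 (not (b == i)) * (Q i u v * 0))
          ≡⟨ cong (1 +_) (sum-zero λ i → trans (cong (𝟙 (not (b == i)) *_) (*-zeroʳ (Q i u v))) (*-zeroʳ (𝟙 (not (b == i))))) ⟩
        1
          ≤⟨ some-colour (col G u v) (u == v) refl refl (B.∨-conicalˡ (u == v) (same b u v) p) ⟩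
        𝟙 (not (u == v) ∧ is-nothing (col G u v)) + rhs ∎

    total-gain : ∀ b → N * N + sum (gain b) ≤ missing + k * (2 * m * N)
    total-gain b = begin
      N * N + sum (gain b)
        ≡⟨ cong (N * N +_) (trans (∑-distrib-+ loss (λ i → 𝟙 (not (b == i)) * shared b i)) (+-comm (sum loss) _)) ⟩
      N * N + (∑[ i < k ] (𝟙 (not (b == i)) * shared b i) + sum loss)
        ≡⟨ +-assoc (N * N) _ (sum loss) ⟨
      N * N + ∑[ i < k ] (𝟙 (not (b == i)) * shared b i) + sum loss
        ≡⟨ cong (_+ sum loss) lhs ⟨
      ∑[ u < N ] ∑[ v < N ] (1 + ∑[ i < k ] (𝟙 (not (b == i)) * (Q i u v * Q b u v))) + sum loss
        ≤⟨ +-monoˡ-≤ (sum loss) (sum-mono λ u → sum-mono (cover b u)) ⟩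
      ∑[ u < N ] ∑[ v < N ] (𝟙 (not (u == v) ∧ is-nothing (col G u v)) + ∑[ i < k ] (Q i u v + R i u v)) + sum loss
        ≡⟨ cong (_+ sum loss) (trans (sum₂-distrib-+ (λ u v → 𝟙 (not (u == v) ∧ is-nothing (col G u v))) (λ u v → ∑[ i < k ] (Q i u v + R i u v))) (cong (missing +_) (exchange (λ i u v → Q i u v + R i u v)))) ⟩
      missing + ∑[ i < k ] ∑[ u < N ] ∑[ v < N ] (Q i u v + R i u v) + sum loss
        ≡⟨ trans (+-assoc missing _ (sum loss)) (cong (missing +_) (sym (∑-distrib-+ (λ i → ∑[ u < N ] ∑[ v < N ] (Q i u v + R i u v)) loss))) ⟩
      missing + ∑[ i < k ] (∑[ u < N ] ∑[ v < N ] (Q i u v + R i u v) + loss i)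
        ≤⟨ +-monoʳ-≤ missing (sum-mono load+loss) ⟩
      missing + ∑[ i < k ] (2 * m * N)
        ≡⟨ cong (missing +_) (sum-const k (2 * m * N)) ⟩
      missing + k * (2 * m * N) ∎
      where
      open ≤-Reasoning
      exchange : (f : Fin k → Fin N → Fin N → ℕ) → ∑[ u < N ] ∑[ v < N ] ∑[ i < k ] f i u v ≡ ∑[ i < k ] ∑[ u < N ] ∑[ v < N ] f i u v
      exchange f = trans (sum-cong-≗ λ u → ∑-comm (λ v i → f i u v)) (∑-comm (λ u i → ∑[ v < N ] f i u v))
      lhs : ∑[ u < N ] ∑[ v < N ] (1 + ∑[ i < k ] (𝟙 (not (b == i)) * (Q i u v * Q b u v))) ≡ N * N + ∑[ i < k ] (𝟙 (not (b == i)) * shared b i)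
      lhs = trans (sum₂-distrib-+ (λ _ _ → 1) (λ u v → ∑[ i < k ] (𝟙 (not (b == i)) * (Q i u v * Q b u v)))) (cong₂ _+_
        (trans (sum-cong-≗ {N} λ u → trans (sum-const N 1) (*-identityʳ N)) (sum-const N N))
        (trans (exchange (λ i u v → 𝟙 (not (b == i)) * (Q i u v * Q b u v)))
          (sum-cong-≗ λ i → trans (sum-cong-≗ λ u → sym (*-distribˡ-sum (𝟙 (not (b == i))) (λ v → Q i u v * Q b u v)))
            (sym (*-distribˡ-sum (𝟙 (not (b == i))) (λ u → ∑[ v < N ] (Q i u v * Q b u v)))))))

-- Numerical inequalities

module Numeric (k′ m f N : ℕ) (3≤k′ : 3 ≤ k′) (N+f : N + f ≡ 2 * suc k′ * m) (2f≤m : 2 * f ≤ m) (m≤3f : m ≤ 3 * f) (0<m : 0 < m) where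
  open ≤-Reasoning

  k : ℕ
  k = suc k′

  0<mm : 0 < m * m
  0<mm = *-mono-≤ 0<m 0<m

  ¬a+b*mm≤a : ∀ a b → ¬ (a + suc b * (m * m) ≤ a)
  ¬a+b*mm≤a a b le = <⇒≱ (≤-trans 0<mm (m≤m+n (m * m) (b * (m * m)))) (+-cancelˡ-≤ a _ _ (≤-trans le (≤-reflexive (sym (+-identityʳ a)))))

  -- As m/3 ≤ f ≤ m/2, the loss `L` is at least m²/2. The X ≥ N - Wᵢ - W_b vertices in both cores
  -- lie in at most k² cells, which forces a large overlap `V`. The ratio 3m/(4k) of the two
  -- parameters is a guess for the average cell, chosen close to it in the tightest case k = 4,
  -- where 120m² ≤ 111m² results.
  pair-contradiction : ∀ Wᵢ W_b L V X → N ≤ X + Wᵢ + W_b →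
    2 * (4 * k) * (3 * m) * X ≤ 4 * k * (4 * k) * V + 3 * m * (3 * m) * (k * k) →
    m * Wᵢ ≤ 2 * L → m * W_b ≤ 2 * (m * m) → 2 * m * f ≤ L + f * f → 16 * (L + V) ≤ 17 * (m * m) → ⊥
  pair-contradiction Wᵢ W_b L V X N≤ cell mWᵢ≤ mW_b≤ hump small = ¬a+b*mm≤a (88 * (m * m) + 23 * (m * m)) 8 (begin
    88 * (m * m) + 23 * (m * m) + 9 * (m * m)   ≡⟨ s₁ (m * m) ⟩
    88 * (m * m) + 32 * (m * m)                 ≤⟨ +-monoʳ-≤ (88 * (m * m)) (≤-trans (*-monoʳ-≤ 32 mm≤2L) (≤-reflexive (s₂ L))) ⟩
    88 * (m * m) + 64 * L                       ≤⟨ upper ⟩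
    111 * (m * m)                               ≡⟨ s₃ (m * m) ⟩
    88 * (m * m) + 23 * (m * m)                 ∎)
    where
    s₁ : ∀ x → 88 * x + 23 * x + 9 * x ≡ 88 * x + 32 * x
    s₁ = solve-∀
    s₂ : ∀ x → 32 * (2 * x) ≡ 64 * x
    s₂ = solve-∀
    s₃ : ∀ x → 111 * x ≡ 88 * x + 23 * x
    s₃ = solve-∀
    mm≤2L : m * m ≤ 2 * L
    mm≤2L = +-cancelʳ-≤ (m * f) _ _ (begin
      m * m + m * f                 ≤⟨ +-monoˡ-≤ (m * f) (*-monoʳ-≤ m m≤3f) ⟩
      m * (3 * f) + m * f           ≡⟨ a₁ m f ⟩
      2 * (2 * m * f)               ≤⟨ *-monoʳ-≤ 2 hump ⟩
      2 * (L + f * f)               ≡⟨ a₂ L f ⟩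
      2 * L + 2 * f * f             ≤⟨ +-monoʳ-≤ (2 * L) (*-monoˡ-≤ f 2f≤m) ⟩
      2 * L + m * f                 ∎)
      where
      a₁ : ∀ m f → m * (3 * f) + m * f ≡ 2 * (2 * m * f)
      a₁ = solve-∀
      a₂ : ∀ L f → 2 * (L + f * f) ≡ 2 * L + 2 * f * f
      a₂ = solve-∀
    cell′ : 24 * m * X ≤ 16 * k * V + 9 * k * (m * m)
    cell′ = *-cancelˡ-≤ k (begin
      k * (24 * m * X)                                    ≡⟨ a₁ k m X ⟩
      2 * (4 * k) * (3 * m) * X                           ≤⟨ cell ⟩
      4 * k * (4 * k) * V + 3 * m * (3 * m) * (k * k)     ≡⟨ a₂ k m V ⟩
      k * (16 * k * V + 9 * k * (m * m))                  ∎)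
      where
      a₁ : ∀ k m X → k * (24 * m * X) ≡ 2 * (4 * k) * (3 * m) * X
      a₁ = solve-∀
      a₂ : ∀ k m V → 4 * k * (4 * k) * V + 3 * m * (3 * m) * (k * k) ≡ k * (16 * k * V + 9 * k * (m * m))
      a₂ = solve-∀
    24mWᵢ≤ : 24 * (m * Wᵢ) ≤ 51 * (m * m)
    24mWᵢ≤ = begin
      24 * (m * Wᵢ)           ≤⟨ *-monoʳ-≤ 24 mWᵢ≤ ⟩
      24 * (2 * L)            ≤⟨ *-monoʳ-≤ 24 (*-monoʳ-≤ 2 (m≤m+n L V)) ⟩
      24 * (2 * (L + V))      ≡⟨ a₁ (L + V) ⟩
      3 * (16 * (L + V))      ≤⟨ *-monoʳ-≤ 3 small ⟩
      3 * (17 * (m * m))      ≡⟨ a₂ (m * m) ⟩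
      51 * (m * m)            ∎
      where
      a₁ : ∀ x → 24 * (2 * x) ≡ 3 * (16 * x)
      a₁ = solve-∀
      a₂ : ∀ x → 3 * (17 * x) ≡ 51 * x
      a₂ = solve-∀
    mass : 48 * k * (m * m) ≤ 16 * k * V + 9 * k * (m * m) + 111 * (m * m)
    mass = begin
      48 * k * (m * m)                                                           ≡⟨ a₁ k m ⟩
      24 * m * (2 * k * m)                                                       ≡⟨ cong (24 * m *_) N+f ⟨
      24 * m * (N + f)                                                           ≤⟨ *-monoʳ-≤ (24 * m) (+-monoˡ-≤ f N≤) ⟩
      24 * m * (X + Wᵢ + W_b + f)                                                ≡⟨ a₂ m X Wᵢ W_b f ⟩
      24 * m * X + (24 * (m * Wᵢ) + 24 * (m * W_b) + 12 * (m * (2 * f)))         ≤⟨ +-mono-≤ cell′ (+-mono-≤ (+-mono-≤ 24mWᵢ≤ (*-monoʳ-≤ 24 mW_b≤)) (*-monoʳ-≤ 12 (*-monoʳ-≤ m 2f≤m))) ⟩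
      16 * k * V + 9 * k * (m * m) + (51 * (m * m) + 24 * (2 * (m * m)) + 12 * (m * m)) ≡⟨ cong (16 * k * V + 9 * k * (m * m) +_) (a₃ (m * m)) ⟩
      16 * k * V + 9 * k * (m * m) + 111 * (m * m)                               ∎
      where
      a₁ : ∀ k m → 48 * k * (m * m) ≡ 24 * m * (2 * k * m)
      a₁ = solve-∀
      a₂ : ∀ m X U W f → 24 * m * (X + U + W + f) ≡ 24 * m * X + (24 * (m * U) + 24 * (m * W) + 12 * (m * (2 * f)))
      a₂ = solve-∀
      a₃ : ∀ x → 51 * x + 24 * (2 * x) + 12 * x ≡ 111 * x
      a₃ = solve-∀
    upper : 88 * (m * m) + 64 * L ≤ 111 * (m * m)
    upper = begin
      88 * (m * m) + 64 * L               ≡⟨ a₁ (m * m) L ⟩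
      4 * (22 * (m * m) + 16 * L)         ≤⟨ *-monoˡ-≤ (22 * (m * m) + 16 * L) (s≤s 3≤k′) ⟩
      k * (22 * (m * m) + 16 * L)         ≤⟨ +-cancelʳ-≤ (26 * k * (m * m) + 16 * k * V) _ _ (begin
        k * (22 * (m * m) + 16 * L) + (26 * k * (m * m) + 16 * k * V)   ≡⟨ a₂ k (m * m) L V ⟩
        48 * k * (m * m) + k * (16 * (L + V))                           ≤⟨ +-mono-≤ mass (*-monoʳ-≤ k small) ⟩
        16 * k * V + 9 * k * (m * m) + 111 * (m * m) + k * (17 * (m * m)) ≡⟨ a₃ k (m * m) V ⟩
        111 * (m * m) + (26 * k * (m * m) + 16 * k * V)                 ∎) ⟩
      111 * (m * m)                       ∎
      where
      a₁ : ∀ x L → 88 * x + 64 * L ≡ 4 * (22 * x + 16 * L)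
      a₁ = solve-∀
      a₂ : ∀ k x L V → k * (22 * x + 16 * L) + (26 * k * x + 16 * k * V) ≡ 48 * k * x + k * (16 * (L + V))
      a₂ = solve-∀
      a₃ : ∀ k x V → 16 * k * V + 9 * k * x + 111 * x + k * (17 * x) ≡ 111 * x + (26 * k * x + 16 * k * V)
      a₃ = solve-∀

  -- If h ≤ m/2, then g ≥ m/2 and g² suffices. Otherwise at least m/2 - m/16 hubs lie in the cores
  -- of the other colour, in at most k cells; the parameters aim at cells of size m/(4k), a total of
  -- m/4.
  hub-bound : ∀ h g W V Y → h + g ≡ m → h ≤ Y + W → 16 * (m * W) ≤ m * m →
    2 * (4 * k) * m * Y ≤ 4 * k * (4 * k) * V + m * m * k → m * m ≤ 8 * k * (g * g + V)
  hub-bound h g W V Y h+g h≤ W≤ cell with ≤-total m (2 * h)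
  ... | inj₁ m≤2h = begin
    m * m                   ≤⟨ *-cancelˡ-≤ 4 (+-cancelʳ-≤ (4 * (m * m)) _ _ main) ⟩
    8 * k * V               ≤⟨ *-monoʳ-≤ (8 * k) (m≤n+m V (g * g)) ⟩
    8 * k * (g * g + V)     ∎
    where
    cell′ : 8 * m * Y ≤ 16 * k * V + m * m
    cell′ = *-cancelˡ-≤ k (begin
      k * (8 * m * Y)                         ≡⟨ a₁ k m Y ⟩
      2 * (4 * k) * m * Y                     ≤⟨ cell ⟩
      4 * k * (4 * k) * V + m * m * k         ≡⟨ a₂ k m V ⟩
      k * (16 * k * V + m * m)                ∎)
      where
      a₁ : ∀ k m Y → k * (8 * m * Y) ≡ 2 * (4 * k) * m * Y
      a₁ = solve-∀
      a₂ : ∀ k m V → 4 * k * (4 * k) * V + m * m * k ≡ k * (16 * k * V + m * m)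
      a₂ = solve-∀
    main : 4 * (m * m) + 4 * (m * m) ≤ 4 * (8 * k * V) + 4 * (m * m)
    main = begin
      4 * (m * m) + 4 * (m * m)                    ≡⟨ a₁ m ⟩
      8 * (m * m)                                  ≤⟨ *-monoʳ-≤ 8 (*-monoʳ-≤ m m≤2h) ⟩
      8 * (m * (2 * h))                            ≤⟨ *-monoʳ-≤ 8 (*-monoʳ-≤ m (*-monoʳ-≤ 2 h≤)) ⟩
      8 * (m * (2 * (Y + W)))                      ≡⟨ a₂ m Y W ⟩
      2 * (8 * m * Y) + 16 * (m * W)               ≤⟨ +-mono-≤ (*-monoʳ-≤ 2 cell′) W≤ ⟩
      2 * (16 * k * V + m * m) + m * m             ≤⟨ m≤m+n _ (m * m) ⟩
      2 * (16 * k * V + m * m) + m * m + m * m     ≡⟨ a₃ k (m * m) V ⟩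
      4 * (8 * k * V) + 4 * (m * m)                ∎
      where
      a₁ : ∀ m → 4 * (m * m) + 4 * (m * m) ≡ 8 * (m * m)
      a₁ = solve-∀
      a₂ : ∀ m Y W → 8 * (m * (2 * (Y + W))) ≡ 2 * (8 * m * Y) + 16 * (m * W)
      a₂ = solve-∀
      a₃ : ∀ k x V → 2 * (16 * k * V + x) + x + x ≡ 4 * (8 * k * V) + 4 * x
      a₃ = solve-∀
  ... | inj₂ 2h≤m = begin
    m * m                    ≤⟨ *-mono-≤ m≤2g m≤2g ⟩
    2 * g * (2 * g)          ≡⟨ a₁ g ⟩
    4 * (g * g)              ≤⟨ *-mono-≤ {4} {8 * k} (≤-trans (m≤m+n 4 4) (*-monoʳ-≤ 8 (s≤s z≤n))) (m≤m+n (g * g) V) ⟩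
    8 * k * (g * g + V)      ∎
    where
    a₁ : ∀ g → 2 * g * (2 * g) ≡ 4 * (g * g)
    a₁ = solve-∀
    m≤2g : m ≤ 2 * g
    m≤2g = +-cancelˡ-≤ (2 * h) m (2 * g) (≤-trans (+-monoˡ-≤ m 2h≤m) (≤-reflexive (trans (cong (m +_) (sym (+-identityʳ m))) (trans (cong (2 *_) (sym h+g)) (*-distribˡ-+ 2 h g)))))

  module Total (S missing : ℕ) (total : N * N + S ≤ missing + k * (2 * m * N)) (16missing≤ : 16 * missing ≤ m * m) where

    -- The scale 16 clears m²/16, and f² is moved to the left to avoid subtraction. Of the k copies
    -- of 2mf in (N + f)f only k - 1 are rounded up to m²; the last is kept exact, to be matched by
    -- the loss of one colour.
    budget : 16 * S + 16 * (f * f) ≤ m * m + 16 * (k′ * (m * m)) + 32 * (m * f)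
    budget = +-cancelˡ-≤ (16 * (N * N)) _ _ (begin
      16 * (N * N) + (16 * S + 16 * (f * f))                   ≡⟨ a₁ (N * N) S (f * f) ⟩
      16 * (N * N + S) + 16 * (f * f)                          ≤⟨ +-monoˡ-≤ (16 * (f * f)) (*-monoʳ-≤ 16 total) ⟩
      16 * (missing + k * (2 * m * N)) + 16 * (f * f)          ≡⟨ a₂ missing k m N f ⟩
      16 * missing + 16 * (2 * k * m * N) + 16 * (f * f)       ≤⟨ +-monoˡ-≤ (16 * (f * f)) (+-monoˡ-≤ (16 * (2 * k * m * N)) 16missing≤) ⟩
      m * m + 16 * (2 * k * m * N) + 16 * (f * f)              ≡⟨ cong (λ x → m * m + 16 * (x * N) + 16 * (f * f)) N+f ⟨
      m * m + 16 * ((N + f) * N) + 16 * (f * f)                ≡⟨ a₃ m N f ⟩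
      16 * (N * N) + (m * m + 16 * ((N + f) * f))              ≡⟨ cong (λ x → 16 * (N * N) + (m * m + 16 * (x * f))) N+f ⟩
      16 * (N * N) + (m * m + 16 * (2 * k * m * f))            ≡⟨ a₄ N m k′ f ⟩
      16 * (N * N) + (m * m + 16 * (k′ * (m * (2 * f))) + 32 * (m * f))  ≤⟨ +-monoʳ-≤ (16 * (N * N)) (+-monoˡ-≤ (32 * (m * f)) (+-monoʳ-≤ (m * m) (*-monoʳ-≤ 16 (*-monoʳ-≤ k′ (*-monoʳ-≤ m 2f≤m))))) ⟩
      16 * (N * N) + (m * m + 16 * (k′ * (m * m)) + 32 * (m * f))        ∎)
      where
      a₁ : ∀ x S y → 16 * x + (16 * S + 16 * y) ≡ 16 * (x + S) + 16 * y
      a₁ = solve-∀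
      a₂ : ∀ x k m N f → 16 * (x + k * (2 * m * N)) + 16 * (f * f) ≡ 16 * x + 16 * (2 * k * m * N) + 16 * (f * f)
      a₂ = solve-∀
      a₃ : ∀ m N f → m * m + 16 * ((N + f) * N) + 16 * (f * f) ≡ 16 * (N * N) + (m * m + 16 * ((N + f) * f))
      a₃ = solve-∀
      a₄ : ∀ N m k′ f → 16 * (N * N) + (m * m + 16 * (2 * suc k′ * m * f)) ≡ 16 * (N * N) + (m * m + 16 * (k′ * (m * (2 * f))) + 32 * (m * f))
      a₄ = solve-∀

    -- Since f(2m - f) ≤ m² - f², the budget is at most km² - f² + m²/16, and f² ≥ m²/9.
    all-lossy : k * (m * m) ≤ S → ⊥
    all-lossy kmm≤S = ¬a+b*mm≤a (9 * (m * m)) 6 (begin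
      9 * (m * m) + 7 * (m * m)   ≡⟨ a₁ (m * m) ⟩
      16 * (m * m)                ≤⟨ *-monoʳ-≤ 16 (*-mono-≤ m≤3f m≤3f) ⟩
      16 * (3 * f * (3 * f))      ≡⟨ a₂ f ⟩
      9 * (16 * (f * f))          ≤⟨ *-monoʳ-≤ 9 16ff≤mm ⟩
      9 * (m * m)                 ∎)
      where
      a₁ : ∀ x → 9 * x + 7 * x ≡ 16 * x
      a₁ = solve-∀
      a₂ : ∀ f → 16 * (3 * f * (3 * f)) ≡ 9 * (16 * (f * f))
      a₂ = solve-∀
      16ff≤mm : 16 * (f * f) ≤ m * m
      16ff≤mm = +-cancelʳ-≤ (16 * (k * (m * m))) _ _ (begin
        16 * (f * f) + 16 * (k * (m * m))                          ≡⟨ +-comm (16 * (f * f)) _ ⟩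
        16 * (k * (m * m)) + 16 * (f * f)                          ≤⟨ +-monoˡ-≤ (16 * (f * f)) (*-monoʳ-≤ 16 kmm≤S) ⟩
        16 * S + 16 * (f * f)                                      ≤⟨ budget ⟩
        m * m + 16 * (k′ * (m * m)) + 32 * (m * f)                 ≡⟨ cong (m * m + 16 * (k′ * (m * m)) +_) (a₃ m f) ⟩
        m * m + 16 * (k′ * (m * m)) + 16 * (m * (2 * f))           ≤⟨ +-monoʳ-≤ (m * m + 16 * (k′ * (m * m))) (*-monoʳ-≤ 16 (*-monoʳ-≤ m 2f≤m)) ⟩
        m * m + 16 * (k′ * (m * m)) + 16 * (m * m)                 ≡⟨ a₄ k′ (m * m) ⟩
        m * m + 16 * (k * (m * m))                                 ∎)
        where
        a₃ : ∀ m f → 32 * (m * f) ≡ 16 * (m * (2 * f))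
        a₃ = solve-∀
        a₄ : ∀ k x → x + 16 * (k * x) + 16 * x ≡ x + 16 * (suc k * x)
        a₄ = solve-∀

    -- First use of the budget: when the other colours gain m² each, what `b` loses beyond f(2m - f)
    -- must fit into m²/16.
    surplus-small : ∀ L E → E + 2 * m * f ≤ L + f * f → k * (m * m) + L ≤ S + m * m → 16 * E ≤ m * m
    surplus-small L E hump le = +-cancelʳ-≤ (16 * (k * (m * m)) + 32 * (m * f)) _ _ (begin
      16 * E + (16 * (k * (m * m)) + 32 * (m * f))               ≡⟨ a₁ E (16 * (k * (m * m))) m f ⟩
      16 * (k * (m * m)) + 16 * (E + 2 * m * f)                  ≤⟨ +-monoʳ-≤ (16 * (k * (m * m))) (*-monoʳ-≤ 16 hump) ⟩
      16 * (k * (m * m)) + 16 * (L + f * f)                      ≡⟨ a₂ (k * (m * m)) L (f * f) ⟩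
      16 * (k * (m * m) + L) + 16 * (f * f)                      ≤⟨ +-monoˡ-≤ (16 * (f * f)) (*-monoʳ-≤ 16 le) ⟩
      16 * (S + m * m) + 16 * (f * f)                            ≡⟨ a₃ S (m * m) (f * f) ⟩
      16 * S + 16 * (f * f) + 16 * (m * m)                       ≤⟨ +-monoˡ-≤ (16 * (m * m)) budget ⟩
      m * m + 16 * (k′ * (m * m)) + 32 * (m * f) + 16 * (m * m)  ≡⟨ a₄ (m * m) k′ (m * f) ⟩
      m * m + (16 * (k * (m * m)) + 32 * (m * f))                ∎)
      where
      a₁ : ∀ E x m f → 16 * E + (x + 32 * (m * f)) ≡ x + 16 * (E + 2 * m * f)
      a₁ = solve-∀
      a₂ : ∀ x L y → 16 * x + 16 * (L + y) ≡ 16 * (x + L) + 16 * y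
      a₂ = solve-∀
      a₃ : ∀ S x y → 16 * (S + x) + 16 * y ≡ 16 * S + 16 * y + 16 * x
      a₃ = solve-∀
      a₄ : ∀ x k y → x + 16 * (k * x) + 32 * y + 16 * x ≡ x + (16 * (suc k * x) + 32 * y)
      a₄ = solve-∀

    -- Second use of the budget, at scale 16k: the bonuses contribute 2(k - 1)m² against an
    -- allowance of km², an excess of (k - 2)m² ≥ 2m².
    finish : ∀ L → 2 * m * f ≤ L + f * f →
      k * ((8 * k + 1) * (m * m)) + 8 * k * L ≤ 8 * k * S + (8 * k + 1) * (m * m) → ⊥
    finish L hump le = ¬a+b*mm≤a X 1
      (+-cancelʳ-≤ (k * (32 * (m * f))) _ _ (begin
        X + 2 * (m * m) + k * (32 * (m * f))
          ≤⟨ a₁ k′ 3≤k′ ⟩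
        2 * (k′ * ((8 * k + 1) * (m * m))) + 16 * k * (2 * m * f)
          ≤⟨ +-monoʳ-≤ (2 * (k′ * ((8 * k + 1) * (m * m)))) (*-monoʳ-≤ (16 * k) hump) ⟩
        2 * (k′ * ((8 * k + 1) * (m * m))) + 16 * k * (L + f * f)
          ≡⟨ a₂ k′ ((8 * k + 1) * (m * m)) k L (f * f) ⟩
        2 * (k′ * ((8 * k + 1) * (m * m)) + 8 * k * L) + 16 * k * (f * f)
          ≤⟨ +-monoˡ-≤ (16 * k * (f * f)) (*-monoʳ-≤ 2 le′) ⟩
        2 * (8 * k * S) + 16 * k * (f * f)
          ≡⟨ a₃ k S (f * f) ⟩
        k * (16 * S + 16 * (f * f))
          ≤⟨ *-monoʳ-≤ k budget ⟩
        k * (m * m + 16 * (k′ * (m * m)) + 32 * (m * f))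
          ≡⟨ a₄ k′ (m * m) (m * f) ⟩
        X + k * (32 * (m * f)) ∎))
      where
      X = k * (m * m + 16 * (k′ * (m * m)))
      le′ : k′ * ((8 * k + 1) * (m * m)) + 8 * k * L ≤ 8 * k * S
      le′ = +-cancelˡ-≤ ((8 * k + 1) * (m * m)) _ _ (≤-trans (≤-reflexive (sym (+-assoc ((8 * k + 1) * (m * m)) _ _))) (≤-trans le (≤-reflexive (+-comm (8 * k * S) _))))
      a₁ : ∀ k → 3 ≤ k → suc k * (m * m + 16 * (k * (m * m))) + 2 * (m * m) + suc k * (32 * (m * f)) ≤ 2 * (k * ((8 * suc k + 1) * (m * m))) + 16 * suc k * (2 * m * f)
      a₁ k 3≤k with ≤-excess 3≤k
      ... | j , refl = ≤-trans (m≤m+n _ (j * (m * m))) (≤-reflexive (ident j (m * m) m f))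
        where
        ident : ∀ j x m f → suc (3 + j) * (x + 16 * ((3 + j) * x)) + 2 * x + suc (3 + j) * (32 * (m * f)) + j * x
          ≡ 2 * ((3 + j) * ((8 * suc (3 + j) + 1) * x)) + 16 * suc (3 + j) * (2 * m * f)
        ident = solve-∀
      a₂ : ∀ k′ x k L y → 2 * (k′ * x) + 16 * k * (L + y) ≡ 2 * (k′ * x + 8 * k * L) + 16 * k * y
      a₂ = solve-∀
      a₃ : ∀ k S y → 2 * (8 * k * S) + 16 * k * y ≡ k * (16 * S + 16 * y)
      a₃ = solve-∀
      a₄ : ∀ k x y → suc k * (x + 16 * (k * x) + 32 * y) ≡ suc k * (x + 16 * (k * x)) + suc k * (32 * y)
      a₄ = solve-∀

-- Overlaps between colours

module Contradiction {N k′ : ℕ} (G : ColouredGraph N (suc k′)) (m f : ℕ)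
  (3≤k′ : 3 ≤ k′) (N+f : N + f ≡ 2 * suc k′ * m) (2f≤m : 2 * f ≤ m) (m≤3f : m ≤ 3 * f) (0<m : 0 < m) where

  open Colours G m
  open Numeric k′ m f N 3≤k′ N+f 2f≤m m≤3f 0<m
  open ≤-Reasoning

  module WithOutcomes (out : ∀ i ℓ → Out.Outcome i ℓ) where

    open Loads out

    coreOf : ∀ i → Fin N → Fin N → Bool
    coreOf i ℓ = Out.Outcome.core (out i ℓ)

    lossOf : ∀ i → Fin N → ℕ
    lossOf i ℓ = Out.Outcome.loss (out i ℓ)

    coreOf⇒cls : ∀ i ℓ v → coreOf i ℓ v ≡ true → cls i v ≡ ℓ
    coreOf⇒cls i ℓ v p = ==-true (Out.Outcome.core⊆C (out i ℓ) v p)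

    coreOf⇒core : ∀ i ℓ v → coreOf i ℓ v ≡ true → core i v ≡ true
    coreOf⇒core i ℓ v p = trans (cong (λ ℓ → coreOf i ℓ v) (coreOf⇒cls i ℓ v p)) p

    AllSmall SomeLarge : Fin k → Set
    AllSmall i = ∀ ℓ → Out.Small i ℓ (coreOf i ℓ) (lossOf i ℓ)
    SomeLarge i = ∃ λ ℓ → Out.Large i ℓ (coreOf i ℓ) (lossOf i ℓ)

    colour-kind : ∀ i → SomeLarge i ⊎ AllSmall i
    colour-kind i = allFin-⊎ λ ℓ → case Out.Outcome.kind (out i ℓ) of λ
      { (inj₁ s) → inj₂ s ; (inj₂ l) → inj₁ (ℓ , l) }

    module NoLarge (i : Fin k) (small : AllSmall i) where

      private module S ℓ = Out.Small i ℓ (small ℓ)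

      open Family {N} m k f N N+f 2f≤m (λ ℓ → count (C i ℓ)) S.deficit S.excess S.waste S.surplus (lossOf i) S.big
        (sum-sizes i) S.size-eq S.deficit≤m S.loss-eq S.m*excess≤ S.m*waste≤ S.waste-or public

      big : Fin N → Bool
      big = S.big

      core⇒big : ∀ v → big (cls i v) ≡ false → core i v ≡ false
      core⇒big v p with core i v in eq
      ... | false = refl
      ... | true = case trans (sym (S.core⇒big (cls i v) v eq)) p of λ ()

      size-waste : N ≡ count (core i) + W
      size-waste = begin-equality
        N                                                      ≡⟨ sum-sizes i ⟨
        ∑[ ℓ < N ] count (C i ℓ)                               ≡⟨ sum-cong-≗ S.waste-eq ⟩
        ∑[ ℓ < N ] (count (coreOf i ℓ) + S.waste ℓ)            ≡⟨ ∑-distrib-+ (λ ℓ → count (coreOf i ℓ)) S.waste ⟩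
        ∑[ ℓ < N ] count (coreOf i ℓ) + W                      ≡⟨ cong (_+ W) (sum-cong-≗ λ ℓ → sum-cong-≗ (pw ℓ)) ⟩
        ∑[ ℓ < N ] ∑[ v < N ] (δ (cls i v) ℓ * 𝟙 (core i v)) + W  ≡⟨ cong (_+ W) (sum-by-label (cls i) (𝟙 ∘ core i)) ⟩
        count (core i) + W                                     ∎
        where
        pw : ∀ ℓ v → 𝟙 (coreOf i ℓ v) ≡ δ (cls i v) ℓ * 𝟙 (core i v)
        pw ℓ v with cls i v F.≟ ℓ
        ... | yes refl = sym (+-identityʳ _)
        ... | no cls≢ with coreOf i ℓ v in eq
        ...   | false = refl
        ...   | true = ⊥-elim (cls≢ (coreOf⇒cls i ℓ v eq))

    count-∧ : ∀ (P Q : Fin N → Bool) W → N ≡ count Q + W → count P ≤ ∑[ v < N ] (𝟙 (P v) * 𝟙 (Q v)) + W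
    count-∧ P Q W N≡ = +-cancelʳ-≤ (count Q) _ _ (begin
      count P + count Q                                         ≡⟨ ∑-distrib-+ (𝟙 ∘ P) (𝟙 ∘ Q) ⟨
      ∑[ v < N ] (𝟙 (P v) + 𝟙 (Q v))                            ≤⟨ sum-mono (λ v → bool (P v) (Q v)) ⟩
      ∑[ v < N ] (𝟙 (P v) * 𝟙 (Q v) + 1)                        ≡⟨ ∑-distrib-+ (λ v → 𝟙 (P v) * 𝟙 (Q v)) (λ _ → 1) ⟩
      ∑[ v < N ] (𝟙 (P v) * 𝟙 (Q v)) + ∑[ v < N ] 1             ≡⟨ cong (X +_) (trans (sum-const N 1) (trans (*-identityʳ N) (trans N≡ (+-comm (count Q) W)))) ⟩
      X + (W + count Q)                                         ≡⟨ +-assoc X W (count Q) ⟨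
      X + W + count Q                                           ∎)
      where
      X = ∑[ v < N ] (𝟙 (P v) * 𝟙 (Q v))
      bool : ∀ x y → 𝟙 x + 𝟙 y ≤ 𝟙 x * 𝟙 y + 1
      bool true true = ≤-refl
      bool true false = ≤-refl
      bool false true = ≤-refl
      bool false false = z≤n

    -- All hubs lie in a single core of colour `i`, so any two of them in one core of `b` form a
    -- shared pair. The cells are therefore indexed by the big classes of `b` alone.
    shared-by-hub : ∀ i ℓ b (small : AllSmall b) (large : Out.Large i ℓ (coreOf i ℓ) (lossOf i ℓ)) → ∀ α β →
      2 * α * β * ∑[ v < N ] (𝟙 (Out.Large.hub large v) * 𝟙 (core b v)) ≤ α * α * shared b i + β * β * NoLarge.p b small
    shared-by-hub i ℓ b small large α β = ≤-trans
      (cells (cls b) w (NoLarge.big b small) w-big α β)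
      (+-monoˡ-≤ (β * β * NoLarge.p b small) (*-monoʳ-≤ (α * α) (sum-mono λ u → sum-mono (pw u))))
      where
      open Out.Large i ℓ large
      w : Fin N → ℕ
      w v = 𝟙 (hub v) * 𝟙 (core b v)
      w-big : ∀ v → NoLarge.big b small (cls b v) ≡ false → w v ≡ 0
      w-big v p = trans (cong (λ x → 𝟙 (hub v) * 𝟙 x) (NoLarge.core⇒big b small v p)) (*-zeroʳ (𝟙 (hub v)))
      bool : ∀ d e s c c′ x y x′ y′ → (x ≡ true → c ≡ true) → (x′ ≡ true → c′ ≡ true) → (x ≡ true → x′ ≡ true → s ≡ true) →
        𝟙 d * (𝟙 x * 𝟙 y * (𝟙 x′ * 𝟙 y′)) ≤ 𝟙 (e ∨ (s ∧ (c ∧ c′))) * 𝟙 (e ∨ (d ∧ (y ∧ y′)))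
      bool false e s c c′ x y x′ y′ f g h = z≤n
      bool true e s c c′ false y x′ y′ f g h = z≤n
      bool true e s c c′ true false x′ y′ f g h = z≤n
      bool true e s c c′ true true false y′ f g h = z≤n
      bool true e s c c′ true true true false f g h = z≤n
      bool true true s c c′ true true true true f g h = ≤-refl
      bool true false s c c′ true true true true f g h with f refl | g refl | h refl refl
      ... | refl | refl | refl = ≤-refl
      pw : ∀ u v → δ (cls b u) (cls b v) * (w u * w v) ≤ Q i u v * Q b u v
      pw u v = bool (cls b u == cls b v) (u == v) (cls i u == cls i v) (core i u) (core i v) (hub u) (core b u) (hub v) (core b v)
        (coreOf⇒core i ℓ u ∘ hub⊆core u) (coreOf⇒core i ℓ v ∘ hub⊆core v)
        (λ p q → dec-true (cls i u F.≟ cls i v) (trans (coreOf⇒cls i ℓ u (hub⊆core u p)) (sym (coreOf⇒cls i ℓ v (hub⊆core v q)))))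

    -- A cell is the intersection of a class of `i` with a class of `b`. Applying `cells` to `b`
    -- within each big class of `i` gives the product of the two numbers of big classes.
    shared-by-pair : ∀ i b (smallᵢ : AllSmall i) (small : AllSmall b) → ∀ α β →
      2 * α * β * ∑[ v < N ] (𝟙 (core i v) * 𝟙 (core b v)) ≤ α * α * shared b i + β * β * (NoLarge.p b small * NoLarge.p i smallᵢ)
    shared-by-pair i b smallᵢ small α β = begin
      2 * α * β * sum x
        ≡⟨ cong (2 * α * β *_) (sum-by-label (cls i) x) ⟨
      2 * α * β * ∑[ ℓ < N ] sum (w ℓ)
        ≡⟨ *-distribˡ-sum (2 * α * β) (sum ∘ w) ⟩
      ∑[ ℓ < N ] (2 * α * β * sum (w ℓ))
        ≤⟨ sum-mono one ⟩
      ∑[ ℓ < N ] (α * α * S ℓ + β * β * p_b * 𝟙 (NoLarge.big i smallᵢ ℓ))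
        ≡⟨ ∑-distrib-+ (λ ℓ → α * α * S ℓ) (λ ℓ → β * β * p_b * 𝟙 (NoLarge.big i smallᵢ ℓ)) ⟩
      ∑[ ℓ < N ] (α * α * S ℓ) + ∑[ ℓ < N ] (β * β * p_b * 𝟙 (NoLarge.big i smallᵢ ℓ))
        ≡⟨ cong₂ _+_ (sym (*-distribˡ-sum (α * α) S)) (trans (sym (*-distribˡ-sum (β * β * p_b) (𝟙 ∘ NoLarge.big i smallᵢ))) (*-assoc (β * β) p_b _)) ⟩
      α * α * sum S + β * β * (p_b * NoLarge.p i smallᵢ)
        ≤⟨ +-monoˡ-≤ (β * β * (p_b * NoLarge.p i smallᵢ)) (*-monoʳ-≤ (α * α) S≤) ⟩
      α * α * shared b i + β * β * (p_b * NoLarge.p i smallᵢ) ∎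
      where
      p_b = NoLarge.p b small
      x : Fin N → ℕ
      x v = 𝟙 (core i v) * 𝟙 (core b v)
      w : Fin N → Fin N → ℕ
      w ℓ v = δ (cls i v) ℓ * x v
      S : Fin N → ℕ
      S ℓ = ∑[ u < N ] ∑[ v < N ] (δ (cls b u) (cls b v) * (w ℓ u * w ℓ v))
      one : ∀ ℓ → 2 * α * β * sum (w ℓ) ≤ α * α * S ℓ + β * β * p_b * 𝟙 (NoLarge.big i smallᵢ ℓ)
      one ℓ with NoLarge.big i smallᵢ ℓ in eq
      ... | true = ≤-trans (cells (cls b) (w ℓ) (NoLarge.big b small) w-big α β) (≤-reflexive (cong (α * α * S ℓ +_) (sym (*-identityʳ (β * β * p_b)))))
        where
        w-big : ∀ v → NoLarge.big b small (cls b v) ≡ false → w ℓ v ≡ 0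
        w-big v p = trans (cong (λ y → δ (cls i v) ℓ * (𝟙 (core i v) * 𝟙 y)) (NoLarge.core⇒big b small v p))
          (trans (cong (δ (cls i v) ℓ *_) (*-zeroʳ (𝟙 (core i v)))) (*-zeroʳ (δ (cls i v) ℓ)))
      ... | false = ≤-trans (≤-reflexive (trans (cong (2 * α * β *_) (sum-zero z)) (*-zeroʳ (2 * α * β)))) z≤n
        where
        z : ∀ v → w ℓ v ≡ 0
        z v with cls i v F.≟ ℓ
        ... | no _ = refl
        ... | yes refl = trans (+-identityʳ (x v)) (cong (λ y → 𝟙 y * 𝟙 (core b v)) (NoLarge.core⇒big i smallᵢ v eq))
      rearrange : ∀ d a p c q → d * (a * p * (c * q)) ≡ a * (d * p * (c * q))
      rearrange = solve-∀
      bool : ∀ d e s c y c′ y′ → 𝟙 d * (𝟙 c * 𝟙 y) * (𝟙 s * (𝟙 c′ * 𝟙 y′)) ≤ 𝟙 (e ∨ (s ∧ (c ∧ c′))) * 𝟙 (e ∨ (d ∧ (y ∧ y′)))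
      bool false e s c y c′ y′ = z≤n
      bool true e s false y c′ y′ = z≤n
      bool true e s true false c′ y′ = z≤n
      bool true e false true true c′ y′ = z≤n
      bool true e true true true false y′ = z≤n
      bool true e true true true true false = z≤n
      bool true true true true true true true = ≤-refl
      bool true false true true true true true = ≤-refl
      S≤ : sum S ≤ shared b i
      S≤ = begin
        sum S
          ≡⟨ ∑-comm (λ ℓ u → ∑[ v < N ] (δ (cls b u) (cls b v) * (w ℓ u * w ℓ v))) ⟩
        ∑[ u < N ] ∑[ ℓ < N ] ∑[ v < N ] (δ (cls b u) (cls b v) * (w ℓ u * w ℓ v))
          ≡⟨ sum-cong-≗ (λ u → ∑-comm (λ ℓ v → δ (cls b u) (cls b v) * (w ℓ u * w ℓ v))) ⟩
        ∑[ u < N ] ∑[ v < N ] ∑[ ℓ < N ] (δ (cls b u) (cls b v) * (w ℓ u * w ℓ v))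
          ≡⟨ sum-cong-≗ (λ u → sum-cong-≗ λ v → trans
               (sum-cong-≗ λ ℓ → rearrange (δ (cls b u) (cls b v)) (δ (cls i u) ℓ) (x u) (δ (cls i v) ℓ) (x v))
               (sum-δ (cls i u) (λ ℓ → δ (cls b u) (cls b v) * x u * (δ (cls i v) ℓ * x v)))) ⟩
        ∑[ u < N ] ∑[ v < N ] (δ (cls b u) (cls b v) * x u * (δ (cls i v) (cls i u) * x v))
          ≤⟨ sum-mono (λ u → sum-mono λ v → ≤-trans (≤-reflexive (cong (λ y → δ (cls b u) (cls b v) * x u * (y * x v)) (δ-sym (cls i v) (cls i u))))
               (bool (cls b u == cls b v) (u == v) (cls i u == cls i v) (core i u) (core b u) (core i v) (core b v))) ⟩
        shared b i ∎

    gain-off : ∀ {i b} → i ≢ b → gain b i ≡ loss i + shared b i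
    gain-off {i} {b} i≢b = cong (loss i +_) (trans (cong (λ x → 𝟙 (not x) * shared b i) (dec-false (b F.≟ i) (i≢b ∘ sym))) (+-identityʳ (shared b i)))

    -- A loss of 3m²/2 is more than enough by itself. Otherwise, denying the claim bounds loss i
    -- below 2m², so that `i`, like `b`, has at most k big classes and the pair estimate applies.
    small-gain : ∀ i b → i ≢ b → AllSmall i → (small : AllSmall b) → loss b < m * m → 17 * (m * m) < 16 * gain b i
    small-gain i b i≢b smallᵢ small L_b<mm = ≰⇒> λ le → contra (≤-trans (≤-reflexive (cong (16 *_) (sym (gain-off i≢b)))) le)
      where
      module I = NoLarge i smallᵢ
      module J = NoLarge b small
      contra : 16 * (loss i + shared b i) ≤ 17 * (m * m) → ⊥
      contra le with I.loss-bound
      ... | inj₂ 3mm≤2L = ¬a+b*mm≤a (17 * (m * m)) 6 (begin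
        17 * (m * m) + 7 * (m * m)        ≡⟨ a₁ (m * m) ⟩
        8 * (3 * (m * m))                 ≤⟨ *-monoʳ-≤ 8 3mm≤2L ⟩
        8 * (2 * loss i)                  ≡⟨ a₂ (loss i) ⟩
        16 * loss i                       ≤⟨ *-monoʳ-≤ 16 (m≤m+n (loss i) (shared b i)) ⟩
        16 * (loss i + shared b i)        ≤⟨ le ⟩
        17 * (m * m)                      ∎)
        where
        a₁ : ∀ x → 17 * x + 7 * x ≡ 8 * (3 * x)
        a₁ = solve-∀
        a₂ : ∀ x → 8 * (2 * x) ≡ 16 * x
        a₂ = solve-∀
      ... | inj₁ hump = pair-contradiction I.W J.W (loss i) (shared b i) (∑[ v < N ] (𝟙 (core i v) * 𝟙 (core b v)))
        (begin
          N                                                          ≡⟨ I.size-waste ⟩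
          count (core i) + I.W                                       ≤⟨ +-monoˡ-≤ I.W (count-∧ (core i) (core b) J.W J.size-waste) ⟩
          X + J.W + I.W                                              ≡⟨ trans (+-assoc X J.W I.W) (trans (cong (X +_) (+-comm J.W I.W)) (sym (+-assoc X I.W J.W))) ⟩
          X + I.W + J.W                                              ∎)
        (≤-trans (shared-by-pair i b smallᵢ small (4 * k) (3 * m))
          (+-monoʳ-≤ (4 * k * (4 * k) * shared b i) (*-monoʳ-≤ (3 * m * (3 * m)) (*-mono-≤ (J.p≤k L_b<2mm) (I.p≤k Lᵢ<2mm)))))
        (≤-trans I.mW≤2E (*-monoʳ-≤ 2 I.E≤L))
        (≤-trans J.mW≤2E (*-monoʳ-≤ 2 (≤-trans J.E≤L (<⇒≤ L_b<mm))))
        (≤-trans (m≤n+m (2 * m * f) I.E) hump)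
        le
        where
        X = ∑[ v < N ] (𝟙 (core i v) * 𝟙 (core b v))
        L_b<2mm : loss b < 2 * (m * m)
        L_b<2mm = ≤-trans L_b<mm (m≤m+n (m * m) _)
        Lᵢ<2mm : loss i < 2 * (m * m)
        Lᵢ<2mm = ≰⇒> λ 2mm≤ → ¬a+b*mm≤a (17 * (m * m)) 14 (begin
          17 * (m * m) + 15 * (m * m)       ≡⟨ a₁ (m * m) ⟩
          16 * (2 * (m * m))                ≤⟨ *-monoʳ-≤ 16 (≤-trans 2mm≤ (m≤m+n (loss i) (shared b i))) ⟩
          16 * (loss i + shared b i)        ≤⟨ le ⟩
          17 * (m * m)                      ∎)
          where
          a₁ : ∀ x → 17 * x + 15 * x ≡ 16 * (2 * x)
          a₁ = solve-∀

    -- The large class itself loses m² + gap². The surplus bound on `b` implies 4E < m², where the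
    -- sharp waste estimate holds, so the cores of `b` miss at most m/16 vertices, as `hub-bound`
    -- requires.
    large-gain : ∀ i b → i ≢ b → SomeLarge i → (small : AllSmall b) → loss b < m * m → 16 * NoLarge.E b small ≤ m * m →
      (8 * k + 1) * (m * m) ≤ 8 * k * gain b i
    large-gain i b i≢b (ℓ , large) small L_b<mm 16E≤mm = begin
      (8 * k + 1) * (m * m)                         ≡⟨ a₁ k (m * m) ⟩
      8 * k * (m * m) + m * m                       ≤⟨ +-monoʳ-≤ (8 * k * (m * m)) extra ⟩
      8 * k * (m * m) + 8 * k * (gap * gap + shared b i) ≡⟨ a₂ (8 * k) (m * m) (gap * gap) (shared b i) ⟩
      8 * k * (m * m + gap * gap + shared b i)      ≤⟨ *-monoʳ-≤ (8 * k) (+-monoˡ-≤ (shared b i) (≤-trans loss≥ (term≤sum (lossOf i) ℓ))) ⟩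
      8 * k * (loss i + shared b i)                 ≡⟨ cong (8 * k *_) (gain-off i≢b) ⟨
      8 * k * gain b i                              ∎
      where
      open Out.Large i ℓ large
      module J = NoLarge b small
      a₁ : ∀ k x → (8 * k + 1) * x ≡ 8 * k * x + x
      a₁ = solve-∀
      a₂ : ∀ k x y z → k * x + k * (y + z) ≡ k * (x + y + z)
      a₂ = solve-∀
      4E<mm : 4 * J.E < m * m
      4E<mm = ≰⇒> λ mm≤4E → ¬a+b*mm≤a (m * m) 2 (begin
        m * m + 3 * (m * m)    ≡⟨⟩
        4 * (m * m)            ≤⟨ *-monoʳ-≤ 4 mm≤4E ⟩
        4 * (4 * J.E)          ≡⟨ *-assoc 4 4 J.E ⟨
        16 * J.E               ≤⟨ 16E≤mm ⟩
        m * m                  ∎)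
      extra : m * m ≤ 8 * k * (gap * gap + shared b i)
      extra = hub-bound (count hub) gap J.W (shared b i) (∑[ v < N ] (𝟙 (hub v) * 𝟙 (core b v))) hub+gap
        (count-∧ hub (core b) J.W J.size-waste)
        (≤-trans (*-monoʳ-≤ 16 (J.mW≤E 4E<mm)) 16E≤mm)
        (≤-trans (shared-by-hub i ℓ b small large (4 * k) m)
          (+-monoʳ-≤ (4 * k * (4 * k) * shared b i) (*-monoʳ-≤ (m * m) (J.p≤k (≤-trans L_b<mm (m≤m+n (m * m) _))))))

    large-loss≥ : ∀ i → SomeLarge i → m * m ≤ loss i
    large-loss≥ i (ℓ , large) = ≤-trans (m≤m+n (m * m) _) (≤-trans (Out.Large.loss≥ large) (term≤sum (lossOf i) ℓ))

    loss≤gain : ∀ b i → loss i ≤ gain b i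
    loss≤gain b i = m≤m+n (loss i) _

    too-dense : 16 * missing ≤ m * m → ⊥
    too-dense 16missing≤ with F.all? (λ i → m * m ≤? loss i)
    -- Any reference colour serves here, since the losses alone exceed the budget.
    ... | yes lossy = Total.all-lossy (sum (gain zero)) missing (total-gain zero) 16missing≤
          (≤-trans (≤-reflexive (sym (sum-const k (m * m)))) (sum-mono λ i → ≤-trans (lossy i) (loss≤gain zero i)))
    ... | no ¬lossy with F.¬∀⟶∃¬ k (λ i → m * m ≤ loss i) (λ i → m * m ≤? loss i) ¬lossy
    ... | b , mm≰L with ≰⇒> mm≰L | colour-kind b
    ... | L<mm | inj₁ large = <⇒≱ L<mm (large-loss≥ b large)
    ... | L<mm | inj₂ small with NoLarge.loss-bound b small
    ... | inj₂ 3mm≤2L = <⇒≱ L<mm (*-cancelˡ-≤ 2 (≤-trans (*-monoˡ-≤ (m * m) {2} {3} (s≤s (s≤s z≤n))) 3mm≤2L))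
    ... | inj₁ hump = finish (loss b) (≤-trans (m≤n+m (2 * m * f) (NoLarge.E b small)) hump) (begin
        k * ((8 * k + 1) * (m * m)) + 8 * k * loss b           ≡⟨ cong (λ x → k * ((8 * k + 1) * (m * m)) + 8 * k * x) gain-b ⟨
        k * ((8 * k + 1) * (m * m)) + 8 * k * gain b b         ≤⟨ sum-off (λ i → 8 * k * gain b i) ((8 * k + 1) * (m * m)) b gain≥ ⟩
        ∑[ i < k ] (8 * k * gain b i) + (8 * k + 1) * (m * m)  ≡⟨ cong (_+ (8 * k + 1) * (m * m)) (*-distribˡ-sum (8 * k) (gain b)) ⟨
        8 * k * sum (gain b) + (8 * k + 1) * (m * m)           ∎)
      where
      open Total (sum (gain b)) missing (total-gain b) 16missing≤
      gain-b : gain b b ≡ loss b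
      gain-b = trans (cong (λ x → loss b + 𝟙 (not x) * shared b b) (==-refl b)) (+-identityʳ (loss b))
      gain≥mm : ∀ i → i ≢ b → m * m ≤ gain b i
      gain≥mm i i≢b with colour-kind i
      ... | inj₁ large = ≤-trans (large-loss≥ i large) (loss≤gain b i)
      ... | inj₂ smallᵢ = *-cancelˡ-≤ 16 (≤-trans (*-monoˡ-≤ (m * m) {16} {17} (n≤1+n 16)) (<⇒≤ (small-gain i b i≢b smallᵢ small L<mm)))
      16E≤mm : 16 * NoLarge.E b small ≤ m * m
      16E≤mm = surplus-small (loss b) (NoLarge.E b small) hump (≤-trans (≤-reflexive (cong (k * (m * m) +_) (sym gain-b))) (sum-off (gain b) (m * m) b gain≥mm))
      gain≥ : ∀ i → i ≢ b → (8 * k + 1) * (m * m) ≤ 8 * k * gain b i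
      gain≥ i i≢b with colour-kind i
      ... | inj₁ large = large-gain i b i≢b large small L<mm 16E≤mm
      -- The factor 17/16 is at least 1 + 1/(8k), because k ≥ 2.
      ... | inj₂ smallᵢ = *-cancelˡ-≤ 2 (begin
        2 * ((8 * k + 1) * (m * m))       ≡⟨ a₁ k (m * m) ⟩
        16 * k * (m * m) + 2 * (m * m)    ≤⟨ +-monoʳ-≤ (16 * k * (m * m)) (*-monoˡ-≤ (m * m) {2} {k} (≤-trans (m≤m+n 2 2) (s≤s 3≤k′))) ⟩
        16 * k * (m * m) + k * (m * m)    ≡⟨ a₂ k (m * m) ⟩
        k * (17 * (m * m))                ≤⟨ *-monoʳ-≤ k (<⇒≤ (small-gain i b i≢b smallᵢ small L<mm)) ⟩
        k * (16 * gain b i)               ≡⟨ a₃ k (gain b i) ⟩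
        2 * (8 * k * gain b i)            ∎)
        where
        a₁ : ∀ k x → 2 * ((8 * k + 1) * x) ≡ 16 * k * x + 2 * x
        a₁ = solve-∀
        a₂ : ∀ k x → 16 * k * x + k * x ≡ k * (17 * x)
        a₂ = solve-∀
        a₃ : ∀ k x → k * (16 * x) ≡ 2 * (8 * k * x)
        a₃ = solve-∀

-- Edges, binomials and the density hypothesis

sumOver : {X : Set} → List X → (X → ℕ) → ℕ
sumOver [] f = 0
sumOver (x ∷ xs) f = f x + sumOver xs f

sumOver-++ : ∀ {X : Set} (xs ys : List X) f → sumOver (xs ++ ys) f ≡ sumOver xs f + sumOver ys f
sumOver-++ [] ys f = refl
sumOver-++ (x ∷ xs) ys f = trans (cong (f x +_) (sumOver-++ xs ys f)) (sym (+-assoc (f x) _ _))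

sumOver-map : ∀ {X Y : Set} (g : X → Y) xs f → sumOver (map g xs) f ≡ sumOver xs (f ∘ g)
sumOver-map g [] f = refl
sumOver-map g (x ∷ xs) f = cong (f (g x) +_) (sumOver-map g xs f)

sumOver-cartesianProduct : ∀ {X Y : Set} (xs : List X) (ys : List Y) f →
  sumOver (cartesianProduct xs ys) f ≡ sumOver xs (λ x → sumOver ys (λ y → f (x , y)))
sumOver-cartesianProduct [] ys f = refl
sumOver-cartesianProduct (x ∷ xs) ys f = trans (sumOver-++ (map (x ,_) ys) _ f)
  (cong₂ _+_ (sumOver-map (x ,_) ys f) (sumOver-cartesianProduct xs ys f))

sumOver-tabulate : ∀ {X : Set} {n} (g : Fin n → X) f → sumOver (tabulate g) f ≡ sum (f ∘ g)
sumOver-tabulate {n = zero} g f = refl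
sumOver-tabulate {n = suc n} g f = cong (f (g zero) +_) (sumOver-tabulate (g ∘ suc) f)

sumOver-pairs : ∀ N (f : Fin N × Fin N → ℕ) →
  sumOver (cartesianProduct (allFin N) (allFin N)) f ≡ ∑[ u < N ] ∑[ v < N ] f (u , v)
sumOver-pairs N f = trans (sumOver-cartesianProduct (allFin N) (allFin N) f)
  (trans (sumOver-tabulate id (λ u → sumOver (allFin N) (λ v → f (u , v))))
    (sum-cong-≗ λ u → sumOver-tabulate id (λ v → f (u , v))))

length-filter₂ : ∀ {X : Set} {P Q : X → Set} (P? : Decidable P) (Q? : Decidable Q) xs →
  length (filter P? (filter Q? xs)) ≡ sumOver xs (λ x → 𝟙 (does (P? x)) * 𝟙 (does (Q? x)))
length-filter₂ P? Q? [] = refl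
length-filter₂ P? Q? (x ∷ xs) with Q? x
... | no _ = trans (length-filter₂ P? Q? xs) (cong (_+ sumOver xs (λ x → 𝟙 (does (P? x)) * 𝟙 (does (Q? x)))) (sym (*-zeroʳ (𝟙 (does (P? x))))))
... | yes _ with P? x
...   | no _ = length-filter₂ P? Q? xs
...   | yes _ = cong suc (length-filter₂ P? Q? xs)

module _ {N k : ℕ} (G : ColouredGraph N k) where

  private
    adj : Fin N → Fin N → Bool
    adj u v = is-just (col G u v)

    up : Fin N → Fin N → ℕ
    up u v = 𝟙 (does (u F.<? v)) * 𝟙 (adj u v)

  edgeCount-sum : edgeCount G ≡ ∑[ u < N ] ∑[ v < N ] up u v
  edgeCount-sum = trans (length-filter₂ _ _ (cartesianProduct (allFin N) (allFin N)))
    (trans (sumOver-pairs N (λ (u , v) → 𝟙 (does (u F.<? v)) * 𝟙 (does (adj u v B.≟ true))))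
      (sum-cong-≗ λ u → sum-cong-≗ λ v → cong (λ x → 𝟙 (does (u F.<? v)) * 𝟙 x) (does-≟-true (adj u v))))
    where
    does-≟-true : ∀ b → does (b B.≟ true) ≡ b
    does-≟-true true = refl
    does-≟-true false = refl

  handshake : ∑[ u < N ] ∑[ v < N ] 𝟙 (adj u v) ≡ 2 * edgeCount G
  handshake = begin
    ∑[ u < N ] ∑[ v < N ] 𝟙 (adj u v)                       ≡⟨ sum-cong-≗ (λ u → sum-cong-≗ (split u)) ⟩
    ∑[ u < N ] ∑[ v < N ] (up u v + up v u)                 ≡⟨ sum₂-distrib-+ up (λ u v → up v u) ⟩
    ∑[ u < N ] ∑[ v < N ] up u v + ∑[ u < N ] ∑[ v < N ] up v u ≡⟨ cong₂ _+_ (sym edgeCount-sum) (trans (∑-comm (λ u v → up v u)) (sym edgeCount-sum)) ⟩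
    edgeCount G + edgeCount G                               ≡⟨ cong (edgeCount G +_) (+-identityʳ (edgeCount G)) ⟨
    2 * edgeCount G                                         ∎
    where
    open ≡-Reasoning
    split : ∀ u v → 𝟙 (adj u v) ≡ up u v + up v u
    split u v with F.<-cmp u v
    ... | tri< u<v _ v≮u rewrite dec-true (u F.<? v) u<v | dec-false (v F.<? u) v≮u =
            trans (sym (+-identityʳ _)) (sym (+-identityʳ _))
    ... | tri≈ u≮v refl _ rewrite dec-false (u F.<? u) u≮v = cong (𝟙 ∘ is-just) (loopless G u)
    ... | tri> u≮v _ v<u rewrite dec-false (u F.<? v) u≮v | dec-true (v F.<? u) v<u =
            trans (cong (𝟙 ∘ is-just) (symmetric G u v)) (sym (+-identityʳ _))

  missing-count : ∑[ u < N ] ∑[ v < N ] 𝟙 (not (u == v) ∧ is-nothing (col G u v)) + N + 2 * edgeCount G ≡ N * N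
  missing-count = begin
    missing + N + 2 * edgeCount G
      ≡⟨ cong₂ (λ x y → missing + x + y) (trans (sum-diagonal {N} (λ _ → 1)) (trans (sum-const N 1) (*-identityʳ N))) handshake ⟨
    missing + ∑[ u < N ] ∑[ v < N ] (δ u v * 1) + ∑[ u < N ] ∑[ v < N ] 𝟙 (adj u v)
      ≡⟨ cong (_+ ∑[ u < N ] ∑[ v < N ] 𝟙 (adj u v)) (sum₂-distrib-+ absent (λ u v → δ u v * 1)) ⟨
    ∑[ u < N ] ∑[ v < N ] (absent u v + δ u v * 1) + ∑[ u < N ] ∑[ v < N ] 𝟙 (adj u v)
      ≡⟨ sum₂-distrib-+ (λ u v → absent u v + δ u v * 1) (λ u v → 𝟙 (adj u v)) ⟨
    ∑[ u < N ] ∑[ v < N ] (absent u v + δ u v * 1 + 𝟙 (adj u v))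
      ≡⟨ sum-cong-≗ (λ u → sum-cong-≗ (one u)) ⟩
    ∑[ u < N ] ∑[ v < N ] 1
      ≡⟨ trans (sum-cong-≗ {N} λ u → trans (sum-const N 1) (*-identityʳ N)) (sum-const N N) ⟩
    N * N ∎
    where
    open ≡-Reasoning
    absent : Fin N → Fin N → ℕ
    absent u v = 𝟙 (not (u == v) ∧ is-nothing (col G u v))
    missing = ∑[ u < N ] ∑[ v < N ] absent u v
    one : ∀ u v → absent u v + δ u v * 1 + 𝟙 (adj u v) ≡ 1
    one u v with u F.≟ v
    ... | yes refl = cong suc (cong (𝟙 ∘ is-just) (loopless G u))
    ... | no _ with col G u v
    ...   | just _ = refl
    ...   | nothing = refl

open import Data.Nat.Combinatorics using (_C_; nC1≡n; nCk+nC[k+1]≡[n+1]C[k+1])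

2*nC2 : ∀ n → 2 * (n C 2) + n ≡ n * n
2*nC2 zero = refl
2*nC2 (suc n) = begin
  2 * (suc n C 2) + suc n             ≡⟨ cong (λ x → 2 * x + suc n) (nCk+nC[k+1]≡[n+1]C[k+1] n 1) ⟨
  2 * (n C 1 + n C 2) + suc n         ≡⟨ cong (λ x → 2 * (x + n C 2) + suc n) (nC1≡n n) ⟩
  2 * (n + n C 2) + suc n             ≡⟨ a₁ n (n C 2) ⟩
  2 * (n C 2) + n + (2 * n + 1)       ≡⟨ cong (_+ (2 * n + 1)) (2*nC2 n) ⟩
  n * n + (2 * n + 1)                 ≡⟨ a₂ n ⟩
  suc n * suc n                       ∎
  where
  open ≡-Reasoning
  a₁ : ∀ n c → 2 * (n + c) + suc n ≡ 2 * c + n + (2 * n + 1)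
  a₁ = solve-∀
  a₂ : ∀ n → n * n + (2 * n + 1) ≡ suc n * suc n
  a₂ = solve-∀

-- Natural numbers inside the rationals

ι : ℕ → ℚ
ι a = ℤ.+ a /ℚ 1

ι-* : ∀ a b → ι a *ℚ ι b ≡ ι (a * b)
ι-* a b = ℚ.toℚᵘ-injective (ℚᵘ.≃-trans (ℚ.toℚᵘ-homo-* (ι a) (ι b)) (ℚᵘ.≃-trans
  (ℚᵘ.*-cong (ℚ.toℚᵘ-fromℚᵘ (mkℚᵘ (ℤ.+ a) 0)) (ℚ.toℚᵘ-fromℚᵘ (mkℚᵘ (ℤ.+ b) 0)))
  (ℚᵘ.≃-trans (*≡* (cong (ℤ._* ℤ.+ 1) (sym (ℤ.pos-* a b)))) (ℚᵘ.≃-sym (ℚ.toℚᵘ-fromℚᵘ (mkℚᵘ (ℤ.+ (a * b)) 0))))))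

ι-+ : ∀ a b → ι a +ℚ ι b ≡ ι (a + b)
ι-+ a b = ℚ.toℚᵘ-injective (ℚᵘ.≃-trans (ℚ.toℚᵘ-homo-+ (ι a) (ι b)) (ℚᵘ.≃-trans
  (ℚᵘ.+-cong (ℚ.toℚᵘ-fromℚᵘ (mkℚᵘ (ℤ.+ a) 0)) (ℚ.toℚᵘ-fromℚᵘ (mkℚᵘ (ℤ.+ b) 0)))
  (ℚᵘ.≃-trans (*≡* (cong (ℤ._* ℤ.+ 1) (cong₂ ℤ._+_ (ℤ.*-identityʳ (ℤ.+ a)) (ℤ.*-identityʳ (ℤ.+ b)))))
    (ℚᵘ.≃-sym (ℚ.toℚᵘ-fromℚᵘ (mkℚᵘ (ℤ.+ (a + b)) 0))))))

ι-cancel-≤ : ∀ {a b} → ι a ≤ℚ ι b → a ≤ b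
ι-cancel-≤ {a} {b} p = ℤ.drop‿+≤+ (subst₂ ℤ._≤_ (ℤ.*-identityʳ (ℤ.+ a)) (ℤ.*-identityʳ (ℤ.+ b))
  (ℚᵘ.drop-*≤* (ℚᵘ.≤-respˡ-≃ (ℚ.toℚᵘ-fromℚᵘ (mkℚᵘ (ℤ.+ a) 0)) (ℚᵘ.≤-respʳ-≃ (ℚ.toℚᵘ-fromℚᵘ (mkℚᵘ (ℤ.+ b) 0)) (ℚ.toℚᵘ-mono-≤ p)))))

-- Scaling the density bound by `K` turns the term with δ into δKc, which is at most c; the rest is
-- an inequality between natural numbers.
clear-δ : ∀ (δ : ℚ) K c e → δ *ℚ ι K <ℚ 1ℚ → (1ℚ - δ) *ℚ ι c ≤ℚ ι e → K * c ≤ K * e + c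
clear-δ δ K c e δK<1 dense = ι-cancel-≤ (begin
  ι (K * c)                                   ≡⟨ ι-* K c ⟨
  ι K *ℚ ι c                                  ≡⟨ cong (ι K *ℚ_) split ⟩
  ι K *ℚ ((1ℚ - δ) *ℚ ι c +ℚ δ *ℚ ι c)        ≤⟨ ℚ.*-monoˡ-≤-nonNeg (ι K) {{ℚ.normalize-nonNeg K 1}} (ℚ.+-monoˡ-≤ (δ *ℚ ι c) dense) ⟩
  ι K *ℚ (ι e +ℚ δ *ℚ ι c)                    ≡⟨ ℚ.*-distribˡ-+ (ι K) (ι e) (δ *ℚ ι c) ⟩
  ι K *ℚ ι e +ℚ ι K *ℚ (δ *ℚ ι c)             ≡⟨ cong₂ _+ℚ_ (ι-* K e) (trans (sym (ℚ.*-assoc (ι K) δ (ι c))) (cong (_*ℚ ι c) (ℚ.*-comm (ι K) δ))) ⟩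
  ι (K * e) +ℚ δ *ℚ ι K *ℚ ι c                ≤⟨ ℚ.+-monoʳ-≤ (ι (K * e)) (ℚ.*-monoʳ-≤-nonNeg (ι c) {{ℚ.normalize-nonNeg c 1}} (ℚ.<⇒≤ δK<1)) ⟩
  ι (K * e) +ℚ 1ℚ *ℚ ι c                      ≡⟨ cong (ι (K * e) +ℚ_) (ℚ.*-identityˡ (ι c)) ⟩
  ι (K * e) +ℚ ι c                            ≡⟨ ι-+ (K * e) c ⟩
  ι (K * e + c)                               ∎)
  where
  open ℚ.≤-Reasoning
  split : ι c ≡ (1ℚ - δ) *ℚ ι c +ℚ δ *ℚ ι c
  split = begin-equality
    ι c                                  ≡⟨ ℚ.*-identityˡ (ι c) ⟨
    1ℚ *ℚ ι c                            ≡⟨ cong (_*ℚ ι c) (trans (cong (1ℚ +ℚ_) (ℚ.+-inverseˡ δ)) (ℚ.+-identityʳ 1ℚ)) ⟨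
    (1ℚ +ℚ (-ℚ δ +ℚ δ)) *ℚ ι c           ≡⟨ cong (_*ℚ ι c) (ℚ.+-assoc 1ℚ (-ℚ δ) δ) ⟨
    (1ℚ - δ +ℚ δ) *ℚ ι c                 ≡⟨ ℚ.*-distribʳ-+ (ι c) (1ℚ - δ) δ ⟩
    (1ℚ - δ) *ℚ ι c +ℚ δ *ℚ ι c          ∎

-- The order of the graph and the number of missing pairs

halve : ∀ m → ∃ λ f → m ≡ 2 * f ⊎ m ≡ 1 + 2 * f
halve zero = 0 , inj₁ refl
halve (suc m) with halve m
... | f , inj₁ refl = f , inj₂ refl
... | f , inj₂ refl = suc f , inj₁ (shift f)
  where
  shift : ∀ f → suc (1 + 2 * f) ≡ 2 * suc f
  shift = solve-∀

halve-≤ : ∀ m f → m ≡ 2 * f ⊎ m ≡ 1 + 2 * f → 2 * f ≤ m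
halve-≤ _ f (inj₁ refl) = ≤-refl
halve-≤ _ f (inj₂ refl) = n≤1+n (2 * f)

-- For m = 1 the half f is 0, so 2 ≤ m is essential; equality occurs at m = 3.
≤-thirds : ∀ m f → 2 ≤ m → m ≡ 2 * f ⊎ m ≡ 1 + 2 * f → m ≤ 3 * f
≤-thirds _ f _ (inj₁ refl) = m≤n+m (2 * f) f
≤-thirds _ zero (s≤s ()) (inj₂ refl)
≤-thirds _ (suc f) _ (inj₂ refl) = +-monoˡ-≤ (2 * suc f) (s≤s z≤n)

quotient : ∀ {a} r → r < 4 → ∀ q → a ≡ r + q * 4 → a / 4 ≡ q
quotient r r<4 q refl = trans (+-distrib-/-∣ʳ r (n∣m*n q)) (cong₂ _+_ (m<n⇒m/n≡0 r<4) (m*n/n≡m q 4))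

4k∸1 : ∀ k → 4 * suc k ∸ 1 ≡ 3 + 4 * k
4k∸1 k = cong (_∸ 1) (shift k)
  where
  shift : ∀ k → 4 * suc k ≡ 4 + 4 * k
  shift = solve-∀

-- The quotient is the ceiling of (4k - 1)n/4 with n = 2m. For even m the division is exact and the
-- added 3 is the remainder; for odd m one half is rounded up and the remainder is 1.
order-eq : ∀ k m f → 4 ≤ k → m ≡ 2 * f ⊎ m ≡ 1 + 2 * f → ((4 * k ∸ 1) * (m * 2) + 3) / 4 + f ≡ 2 * k * m
order-eq (suc k′) _ f _ (inj₁ refl) = trans (cong (_+ f) (quotient 3 (s≤s (s≤s (s≤s (s≤s z≤n)))) (4 * k′ * f + 3 * f)
  (trans (cong (λ x → x * (2 * f * 2) + 3) (4k∸1 k′)) (ident k′ f)))) (ident′ k′ f)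
  where
  ident : ∀ k f → (3 + 4 * k) * (2 * f * 2) + 3 ≡ 3 + (4 * k * f + 3 * f) * 4
  ident = solve-∀
  ident′ : ∀ k f → 4 * k * f + 3 * f + f ≡ 2 * suc k * (2 * f)
  ident′ = solve-∀
order-eq (suc k′) _ f _ (inj₂ refl) = trans (cong (_+ f) (quotient 1 (s≤s (s≤s z≤n)) (4 * k′ * f + 2 * k′ + 3 * f + 2)
  (trans (cong (λ x → x * ((1 + 2 * f) * 2) + 3) (4k∸1 k′)) (ident k′ f)))) (ident′ k′ f)
  where
  ident : ∀ k f → (3 + 4 * k) * ((1 + 2 * f) * 2) + 3 ≡ 1 + (4 * k * f + 2 * k + 3 * f + 2) * 4
  ident = solve-∀
  ident′ : ∀ k f → 4 * k * f + 2 * k + 3 * f + 2 + f ≡ 2 * suc k * (1 + 2 * f)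
  ident′ = solve-∀

-- Ordered missing pairs number 2(c - e). With k + 1 colours, 64(k + 1)² times this is at most 2c ≤
-- N² ≤ 4(k + 1)²m²; the constant 64 in the density hypothesis thus becomes the 16 here.
16*missing≤ : ∀ k m f N c e missing → N + f ≡ 2 * suc k * m → 2 * c + N ≡ N * N → missing + N + 2 * e ≡ N * N →
  64 * suc k * suc k * c ≤ 64 * suc k * suc k * e + c → 16 * missing ≤ m * m
16*missing≤ k m f N c e x N+f 2c x+ le = *-cancelˡ-≤ (4 * (suc k * suc k)) (begin
  4 * (suc k * suc k) * (16 * x)      ≡⟨ a₁ (suc k) x ⟩
  K * x                               ≤⟨ +-cancelʳ-≤ (2 * (K * e)) _ _ (begin
    K * x + 2 * (K * e)                 ≡⟨ a₂ K x e ⟩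
    K * (x + 2 * e)                     ≡⟨ cong (K *_) (+-cancelʳ-≡ N (x + 2 * e) (2 * c) (trans (a₃ x (2 * e) N) (trans x+ (sym 2c)))) ⟩
    K * (2 * c)                         ≡⟨ a₄ K c ⟩
    2 * (K * c)                         ≤⟨ *-monoʳ-≤ 2 le ⟩
    2 * (K * e + c)                     ≡⟨ a₅ (K * e) c ⟩
    2 * c + 2 * (K * e)                 ∎) ⟩
  2 * c                               ≤⟨ m≤m+n (2 * c) N ⟩
  2 * c + N                           ≡⟨ 2c ⟩
  N * N                               ≤⟨ *-mono-≤ N≤ N≤ ⟩
  2 * suc k * m * (2 * suc k * m)     ≡⟨ a₆ (suc k) m ⟩
  4 * (suc k * suc k) * (m * m)       ∎)
  where
  open ≤-Reasoning
  K = 64 * suc k * suc k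
  N≤ : N ≤ 2 * suc k * m
  N≤ = ≤-trans (m≤m+n N f) (≤-reflexive N+f)
  a₁ : ∀ k x → 4 * (k * k) * (16 * x) ≡ 64 * k * k * x
  a₁ = solve-∀
  a₂ : ∀ K x e → K * x + 2 * (K * e) ≡ K * (x + 2 * e)
  a₂ = solve-∀
  a₃ : ∀ x y N → x + y + N ≡ x + N + y
  a₃ = solve-∀
  a₄ : ∀ K c → K * (2 * c) ≡ 2 * (K * c)
  a₄ = solve-∀
  a₅ : ∀ x c → 2 * (x + c) ≡ 2 * c + 2 * x
  a₅ = solve-∀
  a₆ : ∀ k m → 2 * k * m * (2 * k * m) ≡ 4 * (k * k) * (m * m)
  a₆ = solve-∀

dense⇒matching : ∀ k {N} (G : ColouredGraph N k) m f → 4 ≤ k → N + f ≡ 2 * k * m → 2 * f ≤ m → m ≤ 3 * f → 0 < m →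
  64 * k * k * (N C 2) ≤ 64 * k * k * edgeCount G + N C 2 → MonoConnMatching G m
dense⇒matching (suc k′) {N} G m f (s≤s 3≤k′) N+f 2f≤m m≤3f 0<m dense with allFin-⊎ (λ i → allFin-⊎ (Colours.class-outcome G m i))
... | inj₁ matching = matching
... | inj₂ out = ⊥-elim (too-dense (16*missing≤ k′ m f N (N C 2) (edgeCount G) (Colours.Loads.missing G m out) N+f (2*nC2 N) (missing-count G) dense))
  where
  open Contradiction G m f 3≤k′ N+f 2f≤m m≤3f 0<m
  open WithOutcomes out

2≤half : ∀ k m → 4 ≤ k → 32 * k ≤ m * 2 → 2 ≤ m
2≤half k m 4≤k 32k≤2m = *-cancelʳ-≤ 2 m 2 (≤-trans 4≤k (≤-trans (m≤n*m k 32) 32k≤2m))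


open import Data.Integer using (+_)

theorem3 : (k : ℕ) → 4 ≤ k →
    (δ : ℚ) → 0ℚ ≤ℚ δ → δ *ℚ ((+ (64 * k * k)) /ℚ 1) <ℚ 1ℚ →
    (n : ℕ) → 32 * k ≤ n → 2 ∣ n →
    (G : ColouredGraph (((4 * k ∸ 1) * n + 3) / 4) k) →
    (1ℚ - δ) *ℚ ((+ ((((4 * k ∸ 1) * n + 3) / 4) C 2)) /ℚ 1) ≤ℚ (+ edgeCount G) /ℚ 1 →
    MonoConnMatching G (n / 2)
theorem3 k 4≤k δ _ δ< _ 32k≤n (divides m refl) G dense = subst (MonoConnMatching G) (sym (m*n/n≡m m 2))
  (dense⇒matching k G m (proj₁ (halve m)) 4≤k (order-eq k m (proj₁ (halve m)) 4≤k (proj₂ (halve m)))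
    (halve-≤ m (proj₁ (halve m)) (proj₂ (halve m))) (≤-thirds m (proj₁ (halve m)) 2≤m (proj₂ (halve m)))
    (≤-trans (s≤s z≤n) 2≤m) (clear-δ δ (64 * k * k) _ (edgeCount G) δ< dense))
  where
  2≤m : 2 ≤ m
  2≤m = 2≤half k m 4≤k 32k≤n
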